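{- The problem CUTTING $l$ CONNECTED VERTICES is W[1]-hard with parameter $k$ when restricted to balanced 2-track interval graphs, and also when restricted to co-balanced 3-track interval graphs (complements of balanced 3-track interval graphs).
   Context: CUTTING $l$ CONNECTED VERTICES: given a graph $H=(V,E)$ and two integers $k$ and $l$, decide whether there is a partition $V=X\cup S\cup Y$ of the vertices such that $|X|=l$, $|S|\le k$, there is no edge between $X$ and $Y$, and $X$ induces a connected subgraph of $H$. Here only $k$ is the parameter; $l$ is part of the input. The intersection graph of a family of sets has one vertex per member, two different members being adjacent iff they intersect; the family is a representation of the graph. A $t$-track interval is the union of $t$ intervals on $t$ disjoint parallel lines (tracks), one interval on each track. A balanced $t$-track interval graph is the intersection graph of a family of $t$-track intervals in which the $t$ intervals of each $t$-track interval have the same length (intervals from different $t$-track intervals may have different lengths). Such a representation (of $H$, resp. of the complement of $H$) is given as part of the input. A parameterized problem is W[1]-hard if every problem in W[1] has an FPT reduction to it; equivalently, if $k$-CLIQUE in general graphs (parameter $k$) has an FPT reduction to it. An FPT reduction maps an instance $(x,k)$ to an equivalent instance $(x',k')$ in time $g(k)\cdot|x|^{O(1)}$ with $k'\le h(k)$, for computable functions $g,h$. -}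

module Defs where

open import Data.Bool.Base using (if_then_else_)
open import Data.Fin.Base using (Fin)
open import Data.Fin.Properties using (_≟_)
open import Data.Fin.Subset using (Subset; _∈_; _∩_; _∪_; ⊤; Empty; ∣_∣)
open import Data.Integer.Base using (ℤ; +_; -[1+_])
open import Data.List.Base using (List; []; _∷_; _∷ʳ_; _++_; length; map; sum; concatMap; allFin)
open import Data.Nat.Base using (ℕ; zero; suc; _+_; _*_; _∸_; _^_; _≤_; _≡ᵇ_)
open import Data.Nat.Logarithm using (⌈log₂_⌉)
open import Data.Product.Base using (∃-syntax; _×_; _,_)
open import Data.Rational.Base as ℚ using (ℚ; ↥_; ↧ₙ_)
open import Function.Bundles using (_⇔_)
open import Level using (Level; 0ℓ; _⊔_) renaming (suc to lsuc)
open import Relation.Binary.Construct.Closure.ReflexiveTransitive using (Star)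
open import Relation.Binary.Core using (Rel)
open import Relation.Binary.Definitions using (Decidable; Symmetric; Irreflexive)
open import Relation.Binary.PropositionalEquality using (_≡_; _≢_; sym)
open import Relation.Nullary.Decidable.Core using (does)
open import Relation.Nullary.Negation.Core using (¬_)
open import Relation.Unary using (Pred; _≬_)

private
  variable
    a b : Level

-- A structured random access machine with unit cost per elementary step.
-- Words are natural numbers and the only arithmetic is + and ∸, so words
-- gain O(1) bits per step and running time is polynomially related to that
-- of Turing machines.  The input is a read-only sequence of words, the
-- output is write-only.

data Expr : Set where
  lit    : ℕ → Expr
  var    : ℕ → Expr
  mem    : Expr → Expr
  input  : Expr → Expr
  #input : Expr
  _⊕_    : Expr → Expr → Expr
  _⊖_    : Expr → Expr → Expr  -- truncated subtraction

data Program : Set where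
  skip       : Program
  _≔_        : ℕ → Expr → Program
  mem[_]≔_   : Expr → Expr → Program
  emit       : Expr → Program
  _⨟_        : Program → Program → Program
  ifnz_then_else_ : Expr → Program → Program → Program
  whilenz_loop_   : Expr → Program → Program

infix  6 _⊕_ _⊖_
infix  5 _≔_ mem[_]≔_
infixr 4 _⨟_

record State : Set where
  constructor state
  field
    register : ℕ → ℕ
    memory   : ℕ → ℕ
    output   : List ℕ

open State public

initial : State
initial = state (λ _ → 0) (λ _ → 0) []

_[_↦_] : (ℕ → ℕ) → ℕ → ℕ → (ℕ → ℕ)
(f [ i ↦ v ]) j = if j ≡ᵇ i then v else f j

wordAt : List ℕ → ℕ → ℕ
wordAt []       _       = 0
wordAt (w ∷ _)  zero    = w
wordAt (_ ∷ ws) (suc i) = wordAt ws i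

module _ (xs : List ℕ) where

  eval : Expr → State → ℕ
  eval (lit n)   s = n
  eval (var i)   s = register s i
  eval (mem e)   s = memory s (eval e s)
  eval (input e) s = wordAt xs (eval e s)
  eval #input    s = length xs
  eval (d ⊕ e)   s = eval d s + eval e s
  eval (d ⊖ e)   s = eval d s ∸ eval e s

  -- Exec p s t s′: on input xs, p started in s halts in s′ after t steps.
  data Exec : Program → State → ℕ → State → Set where
    skip : ∀ {s} → Exec skip s 1 s
    assign : ∀ {i e s} →
      Exec (i ≔ e) s 1 (record s { register = register s [ i ↦ eval e s ] })
    store : ∀ {d e s} →
      Exec (mem[ d ]≔ e) s 1 (record s { memory = memory s [ eval d s ↦ eval e s ] })
    emit : ∀ {e s} →
      Exec (emit e) s 1 (record s { output = output s ∷ʳ eval e s })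
    seq : ∀ {p q s s′ s″ t t′} →
      Exec p s t s′ → Exec q s′ t′ s″ → Exec (p ⨟ q) s (t + t′) s″
    if-nonzero : ∀ {e p q s s′ t} →
      eval e s ≢ 0 → Exec p s t s′ → Exec (ifnz e then p else q) s (1 + t) s′
    if-zero : ∀ {e p q s s′ t} →
      eval e s ≡ 0 → Exec q s t s′ → Exec (ifnz e then p else q) s (1 + t) s′
    while-zero : ∀ {e p s} →
      eval e s ≡ 0 → Exec (whilenz e loop p) s 1 s
    while-nonzero : ∀ {e p s s′ s″ t t′} →
      eval e s ≢ 0 → Exec p s t s′ → Exec (whilenz e loop p) s′ t′ s″ →
      Exec (whilenz e loop p) s (1 + (t + t′)) s″

-- Within p xs ys B: on input xs, p halts with output ys after at most B steps.
Within : Program → List ℕ → List ℕ → ℕ → Set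
Within p xs ys B =
  ∃[ t ] ∃[ s ] Exec xs p initial t s × output s ≡ ys × t ≤ B

Computable : (ℕ → ℕ) → Set
Computable g = ∃[ p ] ∀ n → ∃[ B ] Within p (n ∷ []) (g n ∷ []) B

record ParameterizedProblem a : Set (lsuc a) where
  field
    Instance  : Set a
    encode    : Instance → List ℕ
    parameter : Instance → ℕ
    Yes       : Pred Instance 0ℓ

-- Length of an encoding in bits.  ⌈log₂ (1 + w) ⌉ is the number of binary
-- digits of w (0 for w = 0); one more is charged as a delimiter.
bitLength : List ℕ → ℕ
bitLength ws = sum (map (λ w → 1 + ⌈log₂ suc w ⌉) ws)

record FPTReduction (P : ParameterizedProblem a) (Q : ParameterizedProblem b) :
                    Set (a ⊔ b) where
  private
    module P = ParameterizedProblem P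
    module Q = ParameterizedProblem Q
  field
    transform    : P.Instance → Q.Instance
    equivalent   : ∀ x → P.Yes x ⇔ Q.Yes (transform x)
    g h          : ℕ → ℕ
    g-computable : Computable g
    h-computable : Computable h
    parameter-≤  : ∀ x → Q.parameter (transform x) ≤ h (P.parameter x)
    program      : Program
    exponent     : ℕ
    runs         : ∀ x → Within program (P.encode x) (Q.encode (transform x))
                     (g (P.parameter x) * bitLength (P.encode x) ^ exponent)

record Graph : Set₁ where
  field
    order  : ℕ
    Adj    : Rel (Fin order) 0ℓ
    symm   : Symmetric Adj
    irrefl : Irreflexive _≡_ Adj

open Graph public

complement : Graph → Graph
complement G = record
  { order  = order G
  ; Adj    = λ u v → u ≢ v × ¬ Adj G u v
  ; symm   = λ (u≢v , ¬uv) → (λ v≡u → u≢v (sym v≡u)) , (λ vu → ¬uv (symm G vu))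
  ; irrefl = λ u≡v (u≢v , _) → u≢v u≡v
  }

IsClique : (G : Graph) → Subset (order G) → Set
IsClique G C = ∀ {u v} → u ∈ C → v ∈ C → u ≢ v → Adj G u v

InducesConnected : (G : Graph) → Subset (order G) → Set
InducesConnected G X =
  ∀ {u v} → u ∈ X → v ∈ X → Star (λ x y → x ∈ X × y ∈ X × Adj G x y) u v

record IsPartition {n} (X S Y : Subset n) : Set where
  field
    cover : X ∪ S ∪ Y ≡ ⊤
    X∩S   : Empty (X ∩ S)
    X∩Y   : Empty (X ∩ Y)
    S∩Y   : Empty (S ∩ Y)

record CliqueInstance : Set₁ where
  field
    graph : Graph
    adj?  : Decidable (Adj graph)
    k     : ℕ

k-Clique : ParameterizedProblem (lsuc 0ℓ)
k-Clique = record
  { Instance  = CliqueInstance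
  ; encode    = enc
  ; parameter = CliqueInstance.k
  ; Yes       = λ x → let open CliqueInstance x in
                  ∃[ C ] ∣ C ∣ ≡ k × IsClique graph C
  }
  where
  enc : CliqueInstance → List ℕ
  enc x = k ∷ order graph ∷
    concatMap (λ u → map (λ v → if does (adj? u v) then 1 else 0) (allFin (order graph)))
              (allFin (order graph))
    where open CliqueInstance x

-- Hardness for W[1], via its complete problem k-Clique.
W[1]-Hard : ParameterizedProblem a → Set (lsuc 0ℓ ⊔ a)
W[1]-Hard Q = FPTReduction k-Clique Q

-- Closed intervals.  Rational endpoints make representations finite objects;
-- every finite (balanced) representation over the reals can be perturbed to
-- one of this kind with the same intersection graph.
record Interval : Set where
  field
    lo hi : ℚ
    lo≤hi : lo ℚ.≤ hi

  len : ℚ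
  len = hi ℚ.- lo

open Interval public

record BalancedTrackInterval (t : ℕ) : Set where
  field
    on       : Fin t → Interval
    balanced : ∀ i j → len (on i) ≡ len (on j)

open BalancedTrackInterval public

-- The union of the t intervals, as a set of points of t disjoint lines.
⟦_⟧ : ∀ {t} → BalancedTrackInterval t → Pred (Fin t × ℚ) 0ℓ
⟦ I ⟧ (i , p) = lo (on I i) ℚ.≤ p × p ℚ.≤ hi (on I i)

record Family (t : ℕ) : Set where
  field
    size   : ℕ
    member : Fin size → BalancedTrackInterval t

intersectionGraph : ∀ {t} → Family t → Graph
intersectionGraph F = record
  { order  = size
  ; Adj    = λ u v → u ≢ v × ⟦ member u ⟧ ≬ ⟦ member v ⟧
  ; symm   = λ (u≢v , x , x∈u , x∈v) → (λ v≡u → u≢v (sym v≡u)) , x , x∈v , x∈u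
  ; irrefl = λ u≡v (u≢v , _) → u≢v u≡v
  }
  where open Family F

encodeℤ : ℤ → List ℕ
encodeℤ (+ n)    = 0 ∷ n ∷ []
encodeℤ -[1+ n ] = 1 ∷ suc n ∷ []

encodeℚ : ℚ → List ℕ
encodeℚ q = encodeℤ (↥ q) ++ ↧ₙ q ∷ []

encodeFamily : ∀ {t} → Family t → List ℕ
encodeFamily {t} F =
  size ∷ concatMap (λ v → concatMap (λ i → encodeInterval (on (member v) i)) (allFin t))
                   (allFin size)
  where
  open Family F
  encodeInterval : Interval → List ℕ
  encodeInterval I = encodeℚ (lo I) ++ encodeℚ (hi I)

HasCut : Graph → (k l : ℕ) → Set
HasCut H k l = ∃[ X ] ∃[ S ] ∃[ Y ]
    IsPartition X S Y
  × ∣ X ∣ ≡ l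
  × ∣ S ∣ ≤ k
  × (∀ {x y} → x ∈ X → y ∈ Y → ¬ Adj H x y)
  × InducesConnected H X

record CuttingInstance (t : ℕ) : Set where
  field
    representation : Family t
    k l            : ℕ

-- The problem on the graphs obtained from balanced t-track representations
-- through graphOf; only k is the parameter.
CuttingConnectedOn : ∀ {t} → (Family t → Graph) → ParameterizedProblem 0ℓ
CuttingConnectedOn {t} graphOf = record
  { Instance  = CuttingInstance t
  ; encode    = λ x → let open CuttingInstance x in k ∷ l ∷ encodeFamily representation
  ; parameter = CuttingInstance.k
  ; Yes       = λ x → let open CuttingInstance x in HasCut (graphOf representation) k l
  }

BalancedTrackCutting : ℕ → ParameterizedProblem 0ℓ
BalancedTrackCutting t = CuttingConnectedOn {t} intersectionGraph

CoBalancedTrackCutting : ℕ → ParameterizedProblem 0ℓ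
CoBalancedTrackCutting t = CuttingConnectedOn {t} (λ F → complement (intersectionGraph F))

{-# OPTIONS --safe #-}

-- For an instance (G, k) with n vertices take a graph H whose vertices are the
-- vertices u of G, all pairs (u, v) with u = v or uv an edge, and more than
-- k + k² hubs for every u.  The hubs form a clique, u is adjacent to its hubs,
-- and the pair (u, v) is adjacent to u and v only.  In a cut with |S| ≤ k
-- and |S ∪ Y| = k + k², every u keeps a hub in X, so Y contains neither
-- vertices nor hubs.  Thus Y consists of at least k² pairs with both ends in S,
-- and these are all pairs over a k-clique.  Conversely, a k-clique S and
-- the pairs Y over it leave a connected set X.  The remaining pairs (u, v) are
-- kept as additional hubs, so that the shape of H does not depend on G, and
-- edges between vertices, or between vertices and further hubs, do not matter:
-- this leaves enough room to represent such graphs H both by balanced 2-track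
-- intervals and by complements of balanced 3-track intervals.
module Submission where

open import Defs
open import Data.Bool.Base using (true; false; if_then_else_)
open import Data.Empty using (⊥)
open import Data.Fin.Base using (Fin; zero; suc; toℕ; combine; remQuot; _↑ˡ_; _↑ʳ_; splitAt)
open import Data.Fin.Properties as Fin using (_≟_; any?; remQuot-combine; combine-remQuot; combine-injective;
  splitAt-↑ˡ; splitAt-↑ʳ; splitAt⁻¹-↑ˡ; splitAt⁻¹-↑ʳ;
  toℕ-combine; toℕ-↑ˡ; toℕ-↑ʳ; toℕ<n; toℕ-injective)
open import Data.Fin.Subset as Subset using (Subset; inside; outside; _∈_; _∩_; _∪_; ∁; ∣_∣; _-_; Empty)
open import Data.Fin.Subset.Properties
open import Data.Integer.Base as ℤ using (+≤+)
import Data.Integer.Properties as ℤ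
open import Data.List.Base using (List; []; _∷_; _++_; _∷ʳ_; length; map; concat; concatMap; tabulate; replicate; allFin)
open import Data.List.Properties using (++-assoc; ++-identityʳ; map-tabulate; tabulate-cong; concat-map; length-++; length-tabulate)
open import Data.Nat.Base hiding (∣_-_∣)
open import Data.Nat.Coprimality using (1-coprimeTo) renaming (sym to coprime-sym)
open import Data.Nat.Properties hiding (_≟_)
open import Data.Nat.Solver using (module +-*-Solver)
open import Data.Product.Base using (∃-syntax; _×_; _,_; proj₁; proj₂; uncurry)
open import Data.Rational.Base as ℚ using (ℚ; mkℚ; *≤*)
import Data.Rational.Properties as ℚ
open import Data.Sum.Base using (_⊎_; inj₁; inj₂)
open import Data.Unit.Base using (⊤; tt)
open import Data.Vec.Base as Vec using ([]; _∷_; here; there)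
open import Data.Vec.Properties using (lookup∘tabulate; lookup⇒[]=; []=⇒lookup)
open import Function.Base using (_∘_; id; case_of_)
open import Function.Bundles using (_⇔_; mk⇔)
open import Relation.Binary.Construct.Closure.ReflexiveTransitive as Star using (Star; ε; _◅_; _◅◅_)
open import Relation.Binary.Definitions using (tri<; tri≈; tri>)
open import Relation.Binary.PropositionalEquality
open import Relation.Nullary using (Dec; yes; no; does; ¬_; contradiction)
open import Relation.Nullary.Decidable using (dec-true; dec-false; _⊎-dec_; _×-dec_)
open import Relation.Unary using (Pred; Decidable)

-- Counting in finite sets

-- Induction on `A`: each element of `A` takes its image out of `B`, which costs `B` at least one
-- element. Injectivity is asked only on `A`, so maps that collide elsewhere, such as forgetting the
-- constructor of an item, can be used.
∣∣-injection : ∀ {m n} (A : Subset m) (B : Subset n) (f : Fin m → Fin n) →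
  (∀ {x} → x ∈ A → f x ∈ B) →
  (∀ {x y} → x ∈ A → y ∈ A → f x ≡ f y → x ≡ y) → ∣ A ∣ ≤ ∣ B ∣
∣∣-injection [] B f into inj = z≤n
∣∣-injection (outside ∷ A) B f into inj =
  ∣∣-injection A B (f ∘ suc) (into ∘ there)
    (λ x∈A y∈A eq → Fin.suc-injective (inj (there x∈A) (there y∈A) eq))
∣∣-injection (inside ∷ A) B f into inj = ≤-<-trans
  (∣∣-injection A (B - f zero) (f ∘ suc)
    (λ x∈A → x∈p∧x≢y⇒x∈p-y (into (there x∈A)) (λ eq → case inj (there x∈A) here eq of λ ()))
    (λ x∈A y∈A eq → Fin.suc-injective (inj (there x∈A) (there y∈A) eq)))
  (x∈p⇒∣p-x∣<∣p∣ (into here))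

∣++∣ : ∀ {m n} (p : Subset m) (q : Subset n) → ∣ p Vec.++ q ∣ ≡ ∣ p ∣ + ∣ q ∣
∣++∣ []            q = refl
∣++∣ (inside ∷ p)  q = cong suc (∣++∣ p q)
∣++∣ (outside ∷ p) q = ∣++∣ p q

∣∪∣-disjoint : ∀ {n} (p q : Subset n) → Empty (p ∩ q) → ∣ p ∪ q ∣ ≡ ∣ p ∣ + ∣ q ∣
∣∪∣-disjoint [] [] _ = refl
∣∪∣-disjoint (inside ∷ p) (inside ∷ q) e = contradiction (zero , here) e
∣∪∣-disjoint (inside ∷ p) (outside ∷ q) e =
  cong suc (∣∪∣-disjoint p q λ (x , m) → e (suc x , there m))
∣∪∣-disjoint (outside ∷ p) (inside ∷ q) e =
  trans (cong suc (∣∪∣-disjoint p q λ (x , m) → e (suc x , there m))) (sym (+-suc _ _))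
∣∪∣-disjoint (outside ∷ p) (outside ∷ q) e =
  ∣∪∣-disjoint p q λ (x , m) → e (suc x , there m)

infixl 7 _⊗_

-- The cartesian product, laid out in the numbering of `combine`: one copy of `D` for each element
-- of `C` and an empty block for every other index.
_⊗_ : ∀ {m n} → Subset m → Subset n → Subset (m * n)
[]            ⊗ D = []
(inside ∷ C)  ⊗ D = D Vec.++ (C ⊗ D)
(outside ∷ C) ⊗ D = Subset.⊥ Vec.++ (C ⊗ D)

∣⊗∣ : ∀ {m n} (C : Subset m) (D : Subset n) → ∣ C ⊗ D ∣ ≡ ∣ C ∣ * ∣ D ∣
∣⊗∣ []            D = refl
∣⊗∣ (inside ∷ C)  D = trans (∣++∣ D (C ⊗ D)) (cong (∣ D ∣ +_) (∣⊗∣ C D))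
∣⊗∣ {n = n} (outside ∷ C) D =
  trans (∣++∣ (Subset.⊥ {n}) (C ⊗ D)) (cong₂ _+_ (∣⊥∣≡0 n) (∣⊗∣ C D))

∈-++⁺ˡ : ∀ {m n} {p : Subset m} {q : Subset n} {x} → x ∈ p → x ↑ˡ n ∈ p Vec.++ q
∈-++⁺ˡ here      = here
∈-++⁺ˡ (there i) = there (∈-++⁺ˡ i)

∈-++⁺ʳ : ∀ {m n} (p : Subset m) {q : Subset n} {x} → x ∈ q → m ↑ʳ x ∈ p Vec.++ q
∈-++⁺ʳ []      i = i
∈-++⁺ʳ (_ ∷ p) i = there (∈-++⁺ʳ p i)

∈-++⁻ˡ : ∀ {m n} (p : Subset m) {q : Subset n} {x} → x ↑ˡ n ∈ p Vec.++ q → x ∈ p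
∈-++⁻ˡ (_ ∷ p) {x = zero}  here      = here
∈-++⁻ˡ (_ ∷ p) {x = suc x} (there i) = there (∈-++⁻ˡ p i)

∈-++⁻ʳ : ∀ {m n} (p : Subset m) {q : Subset n} {x} → m ↑ʳ x ∈ p Vec.++ q → x ∈ q
∈-++⁻ʳ []      i         = i
∈-++⁻ʳ (_ ∷ p) (there i) = ∈-++⁻ʳ p i

∈-⊗⁺ : ∀ {m n} {C : Subset m} {D : Subset n} {u v} → u ∈ C → v ∈ D → combine u v ∈ C ⊗ D
∈-⊗⁺ here v∈D = ∈-++⁺ˡ v∈D
∈-⊗⁺ {C = inside ∷ C}  {D} (there u∈C) v∈D = ∈-++⁺ʳ D (∈-⊗⁺ u∈C v∈D)
∈-⊗⁺ {C = outside ∷ C} (there u∈C) v∈D = ∈-++⁺ʳ Subset.⊥ (∈-⊗⁺ u∈C v∈D)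

∈-⊗⁻ : ∀ {m n} {C : Subset m} {D : Subset n} u v → combine u v ∈ C ⊗ D → u ∈ C × v ∈ D
∈-⊗⁻ {C = inside ∷ C}  {D} zero v i = here , ∈-++⁻ˡ D i
∈-⊗⁻ {C = outside ∷ C} {D} zero v i = contradiction (∈-++⁻ˡ Subset.⊥ i) ∉⊥
∈-⊗⁻ {C = inside ∷ C}  {D} (suc u) v i with ∈-⊗⁻ {C = C} u v (∈-++⁻ʳ D i)
... | u∈C , v∈D = there u∈C , v∈D
∈-⊗⁻ {n = n} {C = outside ∷ C} {D} (suc u) v i with ∈-⊗⁻ {C = C} u v (∈-++⁻ʳ (Subset.⊥ {n}) i)
... | u∈C , v∈D = there u∈C , v∈D

⁅_⁆? : ∀ {n ℓ} {P : Pred (Fin n) ℓ} → Decidable P → Subset n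
⁅ P? ⁆? = Vec.tabulate (does ∘ P?)

module _ {n ℓ} {P : Pred (Fin n) ℓ} (P? : Decidable P) where

  ∈-⁅⁆?⁺ : ∀ {x} → P x → x ∈ ⁅ P? ⁆?
  ∈-⁅⁆?⁺ {x} px = lookup⇒[]= x _ (trans (lookup∘tabulate _ x) (dec-true (P? x) px))

  ∈-⁅⁆?⁻ : ∀ {x} → x ∈ ⁅ P? ⁆? → P x
  ∈-⁅⁆?⁻ {x} i with P? x | trans (sym (lookup∘tabulate (does ∘ P?) x)) ([]=⇒lookup i)
  ... | yes px | _ = px

-- Cuts and cliques

data Item (n N : ℕ) : Set where
  vtx  : Fin n → Item n N
  pair : Fin n → Fin n → Item n N
  hub  : Fin n → Fin N → Item n N

fst snd : ∀ {n N} → Item n N → Fin n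
fst (vtx u)    = u
fst (pair u v) = u
fst (hub u i)  = u
snd (vtx u)    = u
snd (pair u v) = v
snd (hub u i)  = u

-- With ordered pairs and the diagonal included, the good pairs inside a k-clique form a full square
-- with exactly `k * k` elements.
Good : (G : Graph) → Fin (order G) → Fin (order G) → Set
Good G u v = u ≡ v ⊎ Adj G u v

IsHub : ∀ (G : Graph) {N} → Item (order G) N → Set
IsHub G (vtx u)    = ⊥
IsHub G (pair u v) = ¬ Good G u v
IsHub G (hub u i)  = ⊤

-- Apart from the bijection with the items, `pair-only` is the only field that forbids adjacencies;
-- all the others demand them.
record Gadget (G : Graph) (N : ℕ) (H : Graph) : Set where
  field
    item       : Fin (order H) → Item (order G) N
    index      : Item (order G) N → Fin (order H)
    item-index : ∀ a → item (index a) ≡ a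
    index-item : ∀ x → index (item x) ≡ x
    hub-hub    : ∀ a b → IsHub G a → IsHub G b → a ≢ b → Adj H (index a) (index b)
    vtx-hub    : ∀ u i → Adj H (index (vtx u)) (index (hub u i))
    pair-fst   : ∀ u v → Good G u v → Adj H (index (pair u v)) (index (vtx u))
    pair-snd   : ∀ u v → Good G u v → Adj H (index (pair u v)) (index (vtx v))
    pair-only  : ∀ u v b → Good G u v → Adj H (index (pair u v)) (index b) →
                 b ≡ vtx u ⊎ b ≡ vtx v

m*m-cancel-≤ : ∀ {m n} → m * m ≤ n * n → m ≤ n
m*m-cancel-≤ {m} {n} le with m ≤? n
... | yes m≤n = m≤n
... | no m≰n = contradiction le (<⇒≱ (*-mono-< (≰⇒> m≰n) (≰⇒> m≰n)))

module _ (x : CliqueInstance) {H : Graph}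
         (gadget : Gadget (CliqueInstance.graph x)
                     (suc (CliqueInstance.k x + CliqueInstance.k x * CliqueInstance.k x)) H) where
  open CliqueInstance x
  open Gadget gadget

  private
    n N : ℕ
    n = order graph
    N = suc (k + k * k)

    index-injective : ∀ {a b} → index a ≡ index b → a ≡ b
    index-injective {a} {b} eq = trans (sym (item-index a)) (trans (cong item eq) (item-index b))

    good? : ∀ u v → Dec (Good graph u v)
    good? u v = (u ≟ v) ⊎-dec adj? u v

  -- `S` consists of the vertices of the clique and `Y` of the pairs over it, with `k` and `k * k`
  -- elements, so the premise on `l` gives `X` the right size. Connectivity follows by walking from
  -- every item of `X` to a hub.
  clique⇒cut : ∀ {l} → l + (k + k * k) ≡ order H →
    (∃[ C ] ∣ C ∣ ≡ k × IsClique graph C) → HasCut H k l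
  clique⇒cut {l} size (C , ∣C∣ , clique) = X , S , Y , partition , ∣X∣ , ≤-reflexive ∣S∣ , no-edge , connected
    where
    InS InY : Item n N → Set
    InS (vtx u)    = u ∈ C
    InS _          = ⊥
    InY (pair u v) = u ∈ C × v ∈ C
    InY _          = ⊥

    inS? : ∀ a → Dec (InS a)
    inS? (vtx u)    = u ∈? C
    inS? (pair u v) = no λ ()
    inS? (hub u i)  = no λ ()

    inY? : ∀ a → Dec (InY a)
    inY? (vtx u)    = no λ ()
    inY? (pair u v) = (u ∈? C) ×-dec (v ∈? C)
    inY? (hub u i)  = no λ ()

    S Y X : Subset (order H)
    S = ⁅ inS? ∘ item ⁆?
    Y = ⁅ inY? ∘ item ⁆?
    X = ∁ (S ∪ Y)

    index∈S : ∀ {a} → InS a → index a ∈ S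
    index∈S {a} p = ∈-⁅⁆?⁺ (inS? ∘ item) (subst InS (sym (item-index a)) p)

    index∈Y : ∀ {a} → InY a → index a ∈ Y
    index∈Y {a} p = ∈-⁅⁆?⁺ (inY? ∘ item) (subst InY (sym (item-index a)) p)

    index∈X : ∀ {a} → ¬ InS a → ¬ InY a → index a ∈ X
    index∈X {a} ¬s ¬y = x∉p⇒x∈∁p λ i → case x∈p∪q⁻ S Y i of λ where
      (inj₁ s) → ¬s (subst InS (item-index a) (∈-⁅⁆?⁻ (inS? ∘ item) s))
      (inj₂ y) → ¬y (subst InY (item-index a) (∈-⁅⁆?⁻ (inY? ∘ item) y))

    index∈X⁻ : ∀ {a} → index a ∈ X → ¬ InS a × ¬ InY a
    index∈X⁻ {a} i = (λ s → x∈∁p⇒x∉p i (x∈p∪q⁺ (inj₁ (index∈S s)))) ,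
                     (λ y → x∈∁p⇒x∉p i (x∈p∪q⁺ (inj₂ (index∈Y y))))

    disjoint : ∀ a → InS a → InY a → ⊥
    disjoint (vtx u) _ ()

    S∩Y : Empty (S ∩ Y)
    S∩Y (x , i) with x∈p∩q⁻ S Y i
    ... | s , y = disjoint (item x) (∈-⁅⁆?⁻ (inS? ∘ item) s) (∈-⁅⁆?⁻ (inY? ∘ item) y)

    partition : IsPartition X S Y
    partition = record
      { cover = trans (∪-comm X (S ∪ Y)) (∪-inverseʳ (S ∪ Y))
      ; X∩S = λ (x , i) → let (a , b) = x∈p∩q⁻ X S i in x∈∁p⇒x∉p a (x∈p∪q⁺ (inj₁ b))
      ; X∩Y = λ (x , i) → let (a , b) = x∈p∩q⁻ X Y i in x∈∁p⇒x∉p a (x∈p∪q⁺ (inj₂ b))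
      ; S∩Y = S∩Y
      }

    ∣S∣ : ∣ S ∣ ≡ k
    ∣S∣ = trans (≤-antisym
      (∣∣-injection S C (fst ∘ item) (λ s → vtx∈ _ (∈-⁅⁆?⁻ (inS? ∘ item) s))
        (λ {x} {y} s t eq → trans (sym (index-item x)) (trans (cong index
          (vtx-inj _ _ (∈-⁅⁆?⁻ (inS? ∘ item) s) (∈-⁅⁆?⁻ (inS? ∘ item) t) eq)) (index-item y))))
      (∣∣-injection C S (index ∘ vtx) index∈S
        (λ _ _ eq → cong fst (index-injective eq)))) ∣C∣
      where
      vtx∈ : ∀ a → InS a → fst a ∈ C
      vtx∈ (vtx u) p = p
      vtx-inj : ∀ a b → InS a → InS b → fst a ≡ fst b → a ≡ b
      vtx-inj (vtx u) (vtx v) _ _ refl = refl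

    ∣Y∣ : ∣ Y ∣ ≡ k * k
    ∣Y∣ = trans (≤-antisym
      (∣∣-injection Y (C ⊗ C) (λ x → combine (fst (item x)) (snd (item x)))
        (λ y → pair∈ _ (∈-⁅⁆?⁻ (inY? ∘ item) y))
        (λ {x} {y} s t eq → trans (sym (index-item x)) (trans (cong index
          (pair-inj _ _ (∈-⁅⁆?⁻ (inY? ∘ item) s) (∈-⁅⁆?⁻ (inY? ∘ item) t) (combine-injective _ _ _ _ eq))) (index-item y))))
      (∣∣-injection (C ⊗ C) Y (index ∘ uncurry pair ∘ remQuot n)
        (λ {p} i → index∈Y (∈-⊗⁻ _ _ (subst (_∈ C ⊗ C) (sym (combine-remQuot {n} n p)) i)))
        (λ {p} {q} _ _ eq → trans (sym (combine-remQuot {n} n p)) (trans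
          (cong (λ a → combine (fst a) (snd a)) (index-injective eq)) (combine-remQuot {n} n q)))))
      (trans (∣⊗∣ C C) (cong₂ _*_ ∣C∣ ∣C∣))
      where
      pair∈ : ∀ a → InY a → combine (fst a) (snd a) ∈ C ⊗ C
      pair∈ (pair u v) (p , q) = ∈-⊗⁺ p q
      pair-inj : ∀ a b → InY a → InY b → fst a ≡ fst b × snd a ≡ snd b → a ≡ b
      pair-inj (pair _ _) (pair _ _) _ _ (refl , refl) = refl

    ∣X∣ : ∣ X ∣ ≡ l
    ∣X∣ = begin
      ∣ ∁ (S ∪ Y) ∣                             ≡⟨ ∣∁p∣≡n∸∣p∣ (S ∪ Y) ⟩
      order H ∸ ∣ S ∪ Y ∣                       ≡⟨ cong (order H ∸_) (∣∪∣-disjoint S Y S∩Y) ⟩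
      order H ∸ (∣ S ∣ + ∣ Y ∣)                 ≡⟨ cong₂ (λ s y → order H ∸ (s + y)) ∣S∣ ∣Y∣ ⟩
      order H ∸ (k + k * k)                     ≡⟨ cong (_∸ (k + k * k)) size ⟨
      l + (k + k * k) ∸ (k + k * k)             ≡⟨ m+n∸n≡m l (k + k * k) ⟩
      l                                         ∎
      where open ≡-Reasoning

    in-clique : ∀ {u v} → u ∈ C → v ∈ C → Good graph u v
    in-clique {u} {v} p q with u ≟ v
    ... | yes u≡v = inj₁ u≡v
    ... | no u≢v  = inj₂ (clique p q u≢v)

    -- By `pair-only`, a neighbour of a pair over `C` is one of its two ends, and both ends lie in
    -- `S`.
    no-edge : ∀ {x y} → x ∈ X → y ∈ Y → ¬ Adj H x y
    no-edge {x} {y} i j e = go (item y) (∈-⁅⁆?⁻ (inY? ∘ item) j) refl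
      where
      i′ = subst (_∈ X) (sym (index-item x)) i
      go : ∀ b → InY b → item y ≡ b → ⊥
      go (pair u v) (p , q) eq
        with pair-only u v (item x) (in-clique p q)
               (subst₂ (Adj H) (trans (sym (index-item y)) (cong index eq)) (sym (index-item x)) (symm H e))
      ... | inj₁ eq′ = proj₁ (index∈X⁻ i′) (subst InS (sym eq′) p)
      ... | inj₂ eq′ = proj₁ (index∈X⁻ i′) (subst InS (sym eq′) q)

    Step : Fin (order H) → Fin (order H) → Set
    Step x y = x ∈ X × y ∈ X × Adj H x y

    hub∈X : ∀ a → IsHub graph a → index a ∈ X
    hub∈X (pair u v) ¬g = index∈X (λ ()) (λ (p , q) → ¬g (in-clique p q))
    hub∈X (hub u i)  _  = index∈X (λ ()) (λ ())

    vtx∈X : ∀ u → ¬ u ∈ C → index (vtx u) ∈ X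
    vtx∈X u u∉C = index∈X u∉C (λ ())

    ReachesHub : Fin (order H) → Set
    ReachesHub x = ∃[ a ] IsHub graph a × Star Step x (index a)

    from-vtx : ∀ u → ¬ u ∈ C → ReachesHub (index (vtx u))
    -- `N` is a successor, so `u` has a hub even if `k` is 0.
    from-vtx u u∉C = hub u zero , tt ,
      (vtx∈X u u∉C , hub∈X (hub u zero) tt , vtx-hub u zero) ◅ ε

    -- A good pair in `X` cannot have both ends in `C`, as it would then lie in `Y`; an end outside
    -- `C` stays in `X` and leads on to its own hub. A pair that is not good is itself a hub.
    reaches-hub : ∀ a → index a ∈ X → ReachesHub (index a)
    reaches-hub (vtx u) i = from-vtx u (proj₁ (index∈X⁻ i))
    reaches-hub (hub u j) i = hub u j , tt , ε
    reaches-hub (pair u v) i with good? u v | u ∈? C | v ∈? C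
    ... | no ¬g | _       | _       = pair u v , ¬g , ε
    ... | yes g | yes u∈C | yes v∈C = contradiction (u∈C , v∈C) (proj₂ (index∈X⁻ i))
    ... | yes g | no u∉C  | _       =
      let a , h , path = from-vtx u u∉C in a , h , (i , vtx∈X u u∉C , pair-fst u v g) ◅ path
    ... | yes g | yes _   | no v∉C  =
      let a , h , path = from-vtx v v∉C in a , h , (i , vtx∈X v v∉C , pair-snd u v g) ◅ path

    hubs : ∀ a b → IsHub graph a → IsHub graph b → Star Step (index a) (index b)
    hubs a b p q with index a ≟ index b
    ... | yes eq = subst (Star Step (index a)) eq ε
    ... | no neq = (hub∈X a p , hub∈X b q , hub-hub a b p q (neq ∘ cong index)) ◅ ε

    connected : InducesConnected H X
    connected {x} {y} i j
      with reaches-hub (item x) (subst (_∈ X) (sym (index-item x)) i)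
         | reaches-hub (item y) (subst (_∈ X) (sym (index-item y)) j)
    ... | a , p , x→a | b , q , y→b = subst₂ (Star Step) (index-item x) (index-item y)
      (x→a ◅◅ hubs a b p q ◅◅ Star.reverse (λ (i , j , e) → j , i , symm H e) y→b)

  cut⇒clique : ∀ {l} → l + (k + k * k) ≡ order H →
    HasCut H k l → ∃[ C ] ∣ C ∣ ≡ k × IsClique graph C
  cut⇒clique {l} size (X , S , Y , part , ∣X∣ , ∣S∣≤k , no-edge , _) = C , ∣C∣≡k , clique
    where
    open IsPartition part

    X-or-S-or-Y : ∀ x → x ∈ X ⊎ (x ∈ S ⊎ x ∈ Y)
    X-or-S-or-Y x with x∈p∪q⁻ X (S ∪ Y) (subst (x ∈_) (sym cover) ∈⊤)
    ... | inj₁ i = inj₁ i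
    ... | inj₂ i = inj₂ (x∈p∪q⁻ S Y i)

    X∩Y-absurd : ∀ {x} → x ∈ X → x ∈ Y → ⊥
    X∩Y-absurd i j = X∩Y (_ , x∈p∩q⁺ (i , j))

    ∣∁X∣ : ∣ ∁ X ∣ ≡ k + k * k
    ∣∁X∣ = begin
      ∣ ∁ X ∣                ≡⟨ ∣∁p∣≡n∸∣p∣ X ⟩
      order H ∸ ∣ X ∣        ≡⟨ cong₂ _∸_ (sym size) ∣X∣ ⟩
      l + (k + k * k) ∸ l    ≡⟨ m+n∸m≡n l (k + k * k) ⟩
      k + k * k              ∎
      where open ≡-Reasoning

    -- Pigeonhole: `u` has `N` hubs, one more than the `k + k * k` items outside `X`.
    hub-in-X : ∀ u → ∃[ i ] index (hub u i) ∈ X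
    hub-in-X u with any? (λ i → index (hub u i) ∈? X)
    ... | yes found = found
    ... | no none = contradiction
      (subst₂ _≤_ (∣⊤∣≡n N) ∣∁X∣ (∣∣-injection Subset.⊤ (∁ X) (λ i → index (hub u i))
        (λ {i} _ → x∉p⇒x∈∁p (λ m → none (i , m)))
        (λ _ _ eq → hub-inj (index-injective eq))))
      (<-irrefl refl)
      where
      hub-inj : ∀ {u i j} → hub u i ≡ hub {n} {N} u j → i ≡ j
      hub-inj refl = refl

    -- Some hub lies in `X` and is adjacent to every other hub; `fst a` merely supplies a vertex at
    -- which to look for it. The two hubs differ because `X` and `Y` are disjoint.
    hub∉Y : ∀ a → IsHub graph a → ¬ index a ∈ Y
    hub∉Y a h a∈Y with hub-in-X (fst a)
    ... | i , m = no-edge m a∈Y (hub-hub (hub (fst a) i) a tt h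
      λ eq → X∩Y-absurd m (subst (λ b → index b ∈ Y) (sym eq) a∈Y))

    vtx∉Y : ∀ u → ¬ index (vtx u) ∈ Y
    vtx∉Y u u∈Y with hub-in-X u
    ... | i , m = no-edge m u∈Y (symm H (vtx-hub u i))

    C : Subset n
    C = ⁅ (λ u → index (vtx u) ∈? S) ⁆?

    vtx∈C : ∀ u → ¬ index (vtx u) ∈ X → u ∈ C
    vtx∈C u ¬X with X-or-S-or-Y (index (vtx u))
    ... | inj₁ m        = contradiction m ¬X
    ... | inj₂ (inj₁ m) = ∈-⁅⁆?⁺ (λ u → index (vtx u) ∈? S) m
    ... | inj₂ (inj₂ m) = contradiction m (vtx∉Y u)

    data InY : Item n N → Set where
      in-Y : ∀ {u v} → Good graph u v → u ∈ C → v ∈ C → InY (pair u v)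

    inY : ∀ a → index a ∈ Y → InY a
    inY (vtx u)    m = contradiction m (vtx∉Y u)
    inY (hub u i)  m = contradiction m (hub∉Y (hub u i) tt)
    inY (pair u v) m with good? u v
    ... | no ¬g = contradiction m (hub∉Y (pair u v) ¬g)
    ... | yes g = in-Y g (vtx∈C u (λ i → no-edge i m (symm H (pair-fst u v g))))
                         (vtx∈C v (λ i → no-edge i m (symm H (pair-snd u v g))))

    inY-item : ∀ {x} → x ∈ Y → InY (item x)
    inY-item {x} m = inY (item x) (subst (_∈ Y) (sym (index-item x)) m)

    ∣C∣≤k : ∣ C ∣ ≤ k
    ∣C∣≤k = ≤-trans (∣∣-injection C S (index ∘ vtx) (∈-⁅⁆?⁻ (λ u → index (vtx u) ∈? S))
      (λ _ _ eq → cong fst (index-injective eq))) ∣S∣≤k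

    -- `S` accounts for at most `k` of the `k + k * k` items outside `X`, and `Y` for the rest.
    k*k≤∣Y∣ : k * k ≤ ∣ Y ∣
    k*k≤∣Y∣ = +-cancelˡ-≤ k _ _ (begin
      k + k * k          ≡⟨ ∣∁X∣ ⟨
      ∣ ∁ X ∣            ≤⟨ p⊆q⇒∣p∣≤∣q∣ outside-X ⟩
      ∣ S ∪ Y ∣          ≡⟨ ∣∪∣-disjoint S Y S∩Y ⟩
      ∣ S ∣ + ∣ Y ∣      ≤⟨ +-monoˡ-≤ _ ∣S∣≤k ⟩
      k + ∣ Y ∣          ∎)
      where
      open ≤-Reasoning
      outside-X : ∁ X Subset.⊆ S ∪ Y
      outside-X {x} m with X-or-S-or-Y x
      ... | inj₁ i = contradiction i (x∈∁p⇒x∉p m)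
      ... | inj₂ i = x∈p∪q⁺ i

    -- The bound is kept general in `B` for two uses: the whole square `C ⊗ C` forces `C` to have
    -- `k` elements, and the square without one point forces every pair over `C` to occur in `Y`.
    ∣Y∣≤ : ∀ (B : Subset (n * n)) →
      (∀ {u v} → index (pair u v) ∈ Y → u ∈ C → v ∈ C → combine u v ∈ B) → ∣ Y ∣ ≤ ∣ B ∣
    ∣Y∣≤ B into = ∣∣-injection Y B (λ x → combine (fst (item x)) (snd (item x)))
      (λ {x} m → into′ (item x) (subst (_∈ Y) (sym (index-item x)) m) (inY-item m))
      (λ {x} {y} i j eq → trans (sym (index-item x)) (trans (cong index
        (pair-inj _ _ (inY-item i) (inY-item j) (combine-injective _ _ _ _ eq))) (index-item y)))
      where
      into′ : ∀ a → index a ∈ Y → InY a → combine (fst a) (snd a) ∈ B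
      into′ .(pair _ _) m (in-Y _ p q) = into m p q
      pair-inj : ∀ a b → InY a → InY b → fst a ≡ fst b × snd a ≡ snd b → a ≡ b
      pair-inj _ _ (in-Y _ _ _) (in-Y _ _ _) (refl , refl) = refl

    ∣C∣≡k : ∣ C ∣ ≡ k
    ∣C∣≡k = ≤-antisym ∣C∣≤k (m*m-cancel-≤ (begin
      k * k          ≤⟨ k*k≤∣Y∣ ⟩
      ∣ Y ∣          ≤⟨ ∣Y∣≤ (C ⊗ C) (λ _ → ∈-⊗⁺) ⟩
      ∣ C ⊗ C ∣      ≡⟨ ∣⊗∣ C C ⟩
      ∣ C ∣ * ∣ C ∣  ∎))
      where open ≤-Reasoning

    -- If a pair over C were missing, Y would have fewer than k * k elements.
    clique : IsClique graph C
    clique {u} {v} p q u≢v with index (pair u v) ∈? Y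
    ... | yes m with inY _ m
    ...   | in-Y (inj₁ u≡v) _ _ = contradiction u≡v u≢v
    ...   | in-Y (inj₂ e)   _ _ = e
    clique {u} {v} p q u≢v | no ¬m = contradiction (begin-strict
      k * k                       ≤⟨ k*k≤∣Y∣ ⟩
      ∣ Y ∣                       ≤⟨ ∣Y∣≤ (C ⊗ C - combine u v) (λ {u′} {v′} m p′ q′ →
                                       x∈p∧x≢y⇒x∈p-y (∈-⊗⁺ p′ q′) (λ eq → case combine-injective u′ v′ u v eq of
                                         λ { (refl , refl) → ¬m m })) ⟩
      ∣ C ⊗ C - combine u v ∣     <⟨ x∈p⇒∣p-x∣<∣p∣ (∈-⊗⁺ p q) ⟩
      ∣ C ⊗ C ∣                   ≡⟨ ∣⊗∣ C C ⟩
      ∣ C ∣ * ∣ C ∣               ≡⟨ cong₂ _*_ ∣C∣≡k ∣C∣≡k ⟩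
      k * k                       ∎) (<-irrefl refl)
      where open ≤-Reasoning

-- Running time of programs

-- Registers are described by finite lists that read as 0 beyond their end, so that the registers
-- after a sequence of assignments are found by computation. Setting an entry beyond the end pads
-- with zeros.
set : List ℕ → ℕ → ℕ → List ℕ
set []       zero    v = v ∷ []
set []       (suc i) v = 0 ∷ set [] i v
set (_ ∷ ws) zero    v = v ∷ ws
set (w ∷ ws) (suc i) v = w ∷ set ws i v

wordAt-set : ∀ ws i v → wordAt ws [ i ↦ v ] ≗ wordAt (set ws i v)
wordAt-set []       zero    v zero    = refl
wordAt-set []       zero    v (suc j) = refl
wordAt-set []       (suc i) v zero    = refl
wordAt-set []       (suc i) v (suc j) = wordAt-set [] i v j
wordAt-set (_ ∷ ws) zero    v zero    = refl
wordAt-set (_ ∷ ws) zero    v (suc j) = refl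
wordAt-set (_ ∷ ws) (suc i) v zero    = refl
wordAt-set (_ ∷ ws) (suc i) v (suc j) = wordAt-set ws i v j

update-cong : ∀ {f g : ℕ → ℕ} i v → f ≗ g → f [ i ↦ v ] ≗ g [ i ↦ v ]
update-cong i v f≗g j with j ≡ᵇ i
... | true  = refl
... | false = f≗g j

wordAt-replicate-0 : ∀ m i → 0 ≡ wordAt (replicate m 0) i
wordAt-replicate-0 zero    i       = refl
wordAt-replicate-0 (suc m) zero    = refl
wordAt-replicate-0 (suc m) (suc i) = wordAt-replicate-0 m i

emits : List Expr → Program
emits []       = skip
emits (e ∷ es) = emit e ⨟ emits es

module Machine (xs : List ℕ) where

  val : Expr → List ℕ → ℕ
  val e ρ = eval xs e (state (wordAt ρ) (λ _ → 0) [])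

  -- Agreement is pointwise, since the updated register function and the lookup in the updated list
  -- are equal only argument by argument.
  record Agrees (s : State) (ρ : List ℕ) : Set where
    field
      registers : register s ≗ wordAt ρ
      blank     : memory s ≗ (λ _ → 0)

  open Agrees

  eval-agrees : ∀ {s ρ} e → Agrees s ρ → eval xs e s ≡ val e ρ
  eval-agrees (lit n)   a = refl
  eval-agrees (var i)   a = registers a i
  eval-agrees (mem e)   a = blank a _
  eval-agrees (input e) a = cong (wordAt xs) (eval-agrees e a)
  eval-agrees #input    a = refl
  eval-agrees (d ⊕ e)   a = cong₂ _+_ (eval-agrees d a) (eval-agrees e a)
  eval-agrees (d ⊖ e)   a = cong₂ _∸_ (eval-agrees d a) (eval-agrees e a)

  -- A Hoare triple for programs that do not write to memory: from registers ρ,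
  -- p reaches registers σ in at most B steps and appends ws to the output.
  record Runs (p : Program) (ρ : List ℕ) (B : ℕ) (σ : List ℕ) (ws : List ℕ) : Set where
    constructor runs
    field
      from : ∀ s → Agrees s ρ → ∃[ t ] ∃[ s′ ]
        Exec xs p s t s′ × Agrees s′ σ × output s′ ≡ output s ++ ws × t ≤ B

  open Runs

  skip-runs : ∀ {ρ} → Runs skip ρ 1 ρ []
  skip-runs .from s a = _ , _ , skip , a , sym (++-identityʳ _) , ≤-refl

  assign-runs : ∀ i e {ρ} → Runs (i ≔ e) ρ 1 (set ρ i (val e ρ)) []
  assign-runs i e {ρ} .from s a = _ , _ , assign , record
    { registers = λ j → trans (update-cong i _ (registers a) j)
        (trans (cong (λ v → (wordAt ρ [ i ↦ v ]) j) (eval-agrees e a)) (wordAt-set ρ i _ j))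
    ; blank = blank a } , sym (++-identityʳ _) , ≤-refl

  emit-runs : ∀ e {ρ} → Runs (emit e) ρ 1 ρ (val e ρ ∷ [])
  emit-runs e .from s a = _ , _ , emit , record { registers = registers a ; blank = blank a } ,
    cong (output s ∷ʳ_) (eval-agrees e a) , ≤-refl

  infixr 4 _⨟-runs_

  _⨟-runs_ : ∀ {p q ρ σ τ B C ws vs} → Runs p ρ B σ ws → Runs q σ C τ vs →
    Runs (p ⨟ q) ρ (B + C) τ (ws ++ vs)
  _⨟-runs_ {ws = ws} {vs} P Q .from s a with P .from s a
  ... | _ , s′ , x , a′ , o , t≤ with Q .from s′ a′
  ... | _ , s″ , y , a″ , o′ , u≤ =
    _ , _ , seq x y , a″ , trans o′ (trans (cong (_++ vs) o) (++-assoc (output s) ws vs)) , +-mono-≤ t≤ u≤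

  if-nonzero-runs : ∀ {e p q ρ B σ ws} → val e ρ ≢ 0 → Runs p ρ B σ ws →
    Runs (ifnz e then p else q) ρ (1 + B) σ ws
  if-nonzero-runs {e} nz P .from s a with P .from s a
  ... | _ , _ , x , a′ , o , t≤ =
    _ , _ , if-nonzero (λ z → nz (trans (sym (eval-agrees e a)) z)) x , a′ , o , s≤s t≤

  if-zero-runs : ∀ {e p q ρ B σ ws} → val e ρ ≡ 0 → Runs q ρ B σ ws →
    Runs (ifnz e then p else q) ρ (1 + B) σ ws
  if-zero-runs {e} z P .from s a with P .from s a
  ... | _ , _ , x , a′ , o , t≤ =
    _ , _ , if-zero (trans (eval-agrees e a) z) x , a′ , o , s≤s t≤

  -- The invariant gives the exact registers `ρ i` before round `i`. Each round costs one test and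
  -- at most `B` steps, and the failing test costs the final step.
  loop-runs : ∀ {e p B} m (ρ : ℕ → List ℕ) (ws : Fin m → List ℕ) →
    (∀ i → val e (ρ (toℕ {m} i)) ≢ 0) → val e (ρ m) ≡ 0 →
    (∀ i → Runs p (ρ (toℕ i)) B (ρ (suc (toℕ i))) (ws i)) →
    Runs (whilenz e loop p) (ρ 0) (1 + m * (1 + B)) (ρ m) (concat (tabulate ws))
  loop-runs {e} zero ρ ws _ z _ .from s a =
    _ , _ , while-zero (trans (eval-agrees e a) z) , a , sym (++-identityʳ _) , ≤-refl
  loop-runs {e} {B = B} (suc m) ρ ws nz z body .from s a with body zero .from s a
  ... | t , s′ , x , a′ , o , t≤
    with loop-runs m (ρ ∘ suc) (ws ∘ suc) (nz ∘ suc) z (body ∘ suc) .from s′ a′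
  ... | u , s″ , y , a″ , o′ , u≤ = _ , _ ,
    while-nonzero (λ z → nz zero (trans (sym (eval-agrees e a)) z)) x y , a″ ,
    trans o′ (trans (cong (_++ concat (tabulate (ws ∘ suc))) o) (++-assoc (output s) (ws zero) _)) ,
    s≤s (≤-trans (+-mono-≤ t≤ u≤) (≤-reflexive (+-suc B (m * (1 + B)))))

  emits-runs : ∀ es {ρ} → Runs (emits es) ρ (1 + length es) ρ (map (λ e → val e ρ) es)
  emits-runs []       = skip-runs
  emits-runs (e ∷ es) = emit-runs e ⨟-runs emits-runs es

  -- Every `m` describes the initial state; it is chosen to match the length of the register list in
  -- the triple.
  runs⇒within : ∀ {p m B σ ws} → Runs p (replicate m 0) B σ ws → Within p xs ws B
  runs⇒within {m = m} P with P .from initial (record { registers = wordAt-replicate-0 m ; blank = λ _ → refl })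
  ... | t , s , x , _ , o , t≤ = t , s , x , o , t≤

-- Representations with natural endpoints, and the program that writes them

-- Given directly in lowest terms, so that `encodeℚ (ι n)` computes to `0 ∷ n ∷ 1 ∷ []`.
ι : ℕ → ℚ
ι n = mkℚ (ℤ.+ n) 0 (coprime-sym (1-coprimeTo n))

ι-mono : ∀ {m n} → m ≤ n → ι m ℚ.≤ ι n
ι-mono {m} {n} m≤n =
  *≤* (subst₂ ℤ._≤_ (sym (ℤ.*-identityʳ (ℤ.+ m))) (sym (ℤ.*-identityʳ (ℤ.+ n))) (+≤+ m≤n))

ι-cancel-≤ : ∀ {m n} → ι m ℚ.≤ ι n → m ≤ n
ι-cancel-≤ {m} {n} (*≤* le) =
  ℤ.drop‿+≤+ (subst₂ ℤ._≤_ (ℤ.*-identityʳ (ℤ.+ m)) (ℤ.*-identityʳ (ℤ.+ n)) le)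

ι-+ : ∀ m n → ι (m + n) ≡ ι m ℚ.+ ι n
ι-+ m n = trans (sym (ℚ.↥p/↧p≡p (ι (m + n))))
  (cong (ℚ._/ 1) (cong₂ ℤ._+_ (sym (ℤ.*-identityʳ (ℤ.+ m))) (sym (ℤ.*-identityʳ (ℤ.+ n)))))

ι-len : ∀ a l → ι (a + l) ℚ.- ι a ≡ ι l
ι-len a l = begin
  ι (a + l) ℚ.- ι a           ≡⟨ cong (ℚ._- ι a) (trans (cong ι (+-comm a l)) (ι-+ l a)) ⟩
  (ι l ℚ.+ ι a) ℚ.- ι a       ≡⟨ ℚ.+-assoc (ι l) (ι a) (ℚ.- ι a) ⟩
  ι l ℚ.+ (ι a ℚ.- ι a)       ≡⟨ cong (ι l ℚ.+_) (ℚ.+-inverseʳ (ι a)) ⟩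
  ι l ℚ.+ ℚ.0ℚ                ≡⟨ ℚ.+-identityʳ (ι l) ⟩
  ι l                         ∎
  where open ≡-Reasoning

Meet : (a k b l : ℕ) → Set
Meet a k b l = a ≤ b + l × b ≤ a + k

module _ {t : ℕ} (m : ℕ) (lo : Fin m → Fin t → ℕ) (len : Fin m → ℕ) where

  ℕ-family : Family t
  ℕ-family = record
    { size   = m
    ; member = λ x → record
      { on = λ i → record
        { lo    = ι (lo x i)
        ; hi    = ι (lo x i + len x)
        ; lo≤hi = ι-mono (m≤m+n (lo x i) (len x)) }
      ; balanced = λ i j → trans (ι-len (lo x i) (len x)) (sym (ι-len (lo x j) (len x))) }
    }

  Meets : Fin m → Fin m → Set
  Meets x y = ∃[ i ] Meet (lo x i) (len x) (lo y i) (len y)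

  -- The larger of the two left endpoints is a common point.
  meets⇒adj : ∀ {x y} → x ≢ y → Meets x y → Adj (intersectionGraph ℕ-family) x y
  meets⇒adj {x} {y} x≢y (i , p , q) with ≤-total (lo x i) (lo y i)
  ... | inj₁ le = x≢y , (i , ι (lo y i)) ,
    (ι-mono le , ι-mono q) , (ι-mono ≤-refl , ι-mono (m≤m+n _ _))
  ... | inj₂ ge = x≢y , (i , ι (lo x i)) ,
    (ι-mono ≤-refl , ι-mono (m≤m+n _ _)) , (ι-mono ge , ι-mono p)

  adj⇒meets : ∀ {x y} → Adj (intersectionGraph ℕ-family) x y → Meets x y
  adj⇒meets (_ , (i , _) , (a , b) , (c , d)) =
    i , ι-cancel-≤ (ℚ.≤-trans a d) , ι-cancel-≤ (ℚ.≤-trans c b)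

-- Concatenations of blocks and matrices stored by rows

concatMap-allFin : ∀ {A : Set} {m} (f : Fin m → List A) →
  concatMap f (allFin m) ≡ concat (tabulate f)
concatMap-allFin f = cong concat (map-tabulate id f)

concat-tabulate-cong : ∀ {A : Set} {m} {f g : Fin m → List A} → f ≗ g →
  concat (tabulate f) ≡ concat (tabulate g)
concat-tabulate-cong f≗g = cong concat (tabulate-cong f≗g)

concat-tabulate-[] : ∀ {A : Set} m → concat (tabulate {n = m} (λ _ → [])) ≡ [] {A = A}
concat-tabulate-[] zero    = refl
concat-tabulate-[] (suc m) = concat-tabulate-[] m

concat-tabulate-+ : ∀ {A : Set} a b (f : Fin (a + b) → List A) → concat (tabulate f) ≡
  concat (tabulate (f ∘ (_↑ˡ b))) ++ concat (tabulate (f ∘ (a ↑ʳ_)))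
concat-tabulate-+ zero    b f = refl
concat-tabulate-+ (suc a) b f =
  trans (cong (f zero ++_) (concat-tabulate-+ a b (f ∘ suc))) (sym (++-assoc (f zero) _ _))

concat-tabulate-* : ∀ {A : Set} a b (f : Fin (a * b) → List A) → concat (tabulate f) ≡
  concat (tabulate λ i → concat (tabulate λ j → f (combine {a} {b} i j)))
concat-tabulate-* zero    b f = refl
concat-tabulate-* (suc a) b f = trans (concat-tabulate-+ b (a * b) f)
  (cong (concat (tabulate (f ∘ (_↑ˡ (a * b)))) ++_) (concat-tabulate-* a b (f ∘ (b ↑ʳ_))))

length-concat-tabulate : ∀ {A : Set} {m l} (f : Fin m → List A) → (∀ i → length (f i) ≡ l) →
  length (concat (tabulate f)) ≡ m * l
length-concat-tabulate {m = zero}  f eq = refl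
length-concat-tabulate {m = suc m} f eq =
  trans (length-++ (f zero)) (cong₂ _+_ (eq zero) (length-concat-tabulate (f ∘ suc) (eq ∘ suc)))

wordAt-++ˡ : ∀ {n} (f : Fin n → ℕ) ys i → wordAt (tabulate f ++ ys) (toℕ i) ≡ f i
wordAt-++ˡ f ys zero    = refl
wordAt-++ˡ f ys (suc i) = wordAt-++ˡ (f ∘ suc) ys i

wordAt-++ʳ : ∀ xs ys i → wordAt (xs ++ ys) (length xs + i) ≡ wordAt ys i
wordAt-++ʳ []       ys i = refl
wordAt-++ʳ (_ ∷ xs) ys i = wordAt-++ʳ xs ys i

wordAt-matrix : ∀ {m n} (f : Fin m → Fin n → ℕ) u v →
  wordAt (concat (tabulate (tabulate ∘ f))) (toℕ v + toℕ u * n) ≡ f u v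
wordAt-matrix f zero v =
  trans (cong (wordAt (tabulate (f zero) ++ rows)) (+-identityʳ (toℕ v))) (wordAt-++ˡ (f zero) rows v)
  where rows = concat (tabulate (tabulate ∘ f ∘ suc))
wordAt-matrix {n = n} f (suc u) v = begin
  wordAt (row ++ rows) (toℕ v + (n + toℕ u * n))          ≡⟨ cong (wordAt (row ++ rows)) shift ⟩
  wordAt (row ++ rows) (length row + (toℕ v + toℕ u * n)) ≡⟨ wordAt-++ʳ row rows _ ⟩
  wordAt rows (toℕ v + toℕ u * n)                         ≡⟨ wordAt-matrix (f ∘ suc) u v ⟩
  f (suc u) v                                             ∎
  where
  open ≡-Reasoning
  row  = tabulate (f zero)
  rows = concat (tabulate (tabulate ∘ f ∘ suc))
  shift : toℕ v + (n + toℕ u * n) ≡ length row + (toℕ v + toℕ u * n)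
  shift = trans (trans (sym (+-assoc (toℕ v) n _)) (trans (cong (_+ toℕ u * n) (+-comm (toℕ v) n)) (+-assoc n _ _)))
                (cong (_+ (toℕ v + toℕ u * n)) (sym (length-tabulate (f zero))))

-- Numbering of the items: for each `u` the vertex, its pairs, its hubs

module _ {n N : ℕ} where

  itemIndex : Item n N → Fin (n * suc (n + N))
  itemIndex (vtx u)    = combine u zero
  itemIndex (pair u v) = combine u (suc (v ↑ˡ N))
  itemIndex (hub u i)  = combine u (suc (n ↑ʳ i))

  itemIn : Fin n → Fin (suc (n + N)) → Item n N
  itemIn u zero    = vtx u
  itemIn u (suc j) with splitAt n j
  ... | inj₁ v = pair u v
  ... | inj₂ i = hub u i

  itemAt : Fin (n * suc (n + N)) → Item n N
  itemAt x = uncurry itemIn (remQuot (suc (n + N)) x)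

  itemAt-combine : ∀ u j → itemAt (combine u j) ≡ itemIn u j
  itemAt-combine u j = cong (uncurry itemIn) (remQuot-combine u j)

  itemAt-index : ∀ a → itemAt (itemIndex a) ≡ a
  itemAt-index (vtx u) = itemAt-combine u zero
  itemAt-index (pair u v) = trans (itemAt-combine u (suc (v ↑ˡ N))) eq
    where
    eq : itemIn u (suc (v ↑ˡ N)) ≡ pair u v
    eq rewrite splitAt-↑ˡ n v N = refl
  itemAt-index (hub u i) = trans (itemAt-combine u (suc (n ↑ʳ i))) eq
    where
    eq : itemIn u (suc (n ↑ʳ i)) ≡ hub u i
    eq rewrite splitAt-↑ʳ n N i = refl

  itemIndex-in : ∀ u j → itemIndex (itemIn u j) ≡ combine u j
  itemIndex-in u zero = refl
  itemIndex-in u (suc j) with splitAt n j in eq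
  ... | inj₁ v = cong (combine u ∘ suc) (splitAt⁻¹-↑ˡ eq)
  ... | inj₂ i = cong (combine u ∘ suc) (splitAt⁻¹-↑ʳ eq)

  itemIndex-at : ∀ x → itemIndex (itemAt x) ≡ x
  itemIndex-at x = trans (itemIndex-in _ _) (combine-remQuot {n} (suc (n + N)) x)

-- Register 0 is a loop counter, 1 holds `k * k`, 2 the number `T` of items, 3 and 5 the vertices
-- `u` and `v`, 4 and 6 their multiples by `D`, 7 the position in the adjacency matrix and 8 the
-- number of items emitted. The machine cannot multiply, so all products are maintained by repeated
-- addition.
kᴱ nᴱ Nᴱ Tᴱ Dᴱ uᴱ uDᴱ vᴱ vDᴱ qᴱ : Expr
kᴱ  = input (lit 0)
nᴱ  = input (lit 1)
Nᴱ  = lit 1 ⊕ (kᴱ ⊕ var 1)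
Tᴱ  = var 2
Dᴱ  = nᴱ ⊕ (Tᴱ ⊕ lit 2)
uᴱ  = var 3
uDᴱ = var 4
vᴱ  = var 5
vDᴱ = var 6
qᴱ  = var 8

data Kind : Set where
  vertex edge filler : Kind

-- The same expressions define the intervals, through `val`, and are emitted by the program. The
-- length does not depend on the track, which makes the representation balanced.
record Layout (t : ℕ) : Set where
  field
    loᴱ  : Kind → Fin t → Expr
    lenᴱ : Kind → Expr

times : ℕ → Expr → Expr
times zero    e = lit 0
times (suc c) e = e ⊕ times c e

module _ (xs : List ℕ) where
  open Machine xs

  val-times : ∀ c e {ρ} → val (times c e) ρ ≡ c * val e ρ
  val-times zero    e = refl
  val-times (suc c) e {ρ} = cong (val e ρ +_) (val-times c e {ρ})

square : Program
square = (whilenz kᴱ ⊖ var 0 loop (1 ≔ kᴱ ⊕ var 1 ⨟ 0 ≔ lit 1 ⊕ var 0)) ⨟ 0 ≔ lit 0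

total : Program
total = (whilenz nᴱ ⊖ var 0 loop (2 ≔ (lit 1 ⊕ (nᴱ ⊕ Nᴱ)) ⊕ var 2 ⨟ 0 ≔ lit 1 ⊕ var 0)) ⨟ 0 ≔ lit 0

n∸toℕ≢0 : ∀ {n} (i : Fin n) → n ∸ toℕ i ≢ 0
n∸toℕ≢0 i = m<n⇒m∸n≢0 (toℕ<n i) where
  m<n⇒m∸n≢0 : ∀ {m n} → m < n → n ∸ m ≢ 0
  m<n⇒m∸n≢0 m<n eq = <⇒≱ m<n (m∸n≡0⇒m≤n eq)

module _ (k : ℕ) (ws : List ℕ) where
  open Machine (k ∷ ws)

  square-runs : ∀ {ρ} → Runs square (0 ∷ 0 ∷ ρ) (1 + k * 3 + 1) (0 ∷ k * k ∷ ρ) []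
  square-runs {ρ} = subst (Runs _ _ _ _) (trans (++-identityʳ _) (concat-tabulate-[] k))
    (loop-runs k (λ j → j ∷ j * k ∷ ρ) (λ _ → []) n∸toℕ≢0 (n∸n≡0 k)
      (λ _ → assign-runs 1 (kᴱ ⊕ var 1) ⨟-runs assign-runs 0 (lit 1 ⊕ var 0))
     ⨟-runs assign-runs 0 (lit 0))

scale-computable : ∀ c → Computable (λ k → c * suc (k + k * k))
scale-computable c = (square ⨟ emit (times c Nᴱ)) , λ k → let open Machine (k ∷ []) in
  _ , runs⇒within {m = 2} (subst (λ w → Runs _ _ _ _ (w ∷ [])) (val-times (k ∷ []) c Nᴱ {0 ∷ k * k ∷ []})
    (square-runs k [] ⨟-runs emit-runs (times c Nᴱ)))

id-computable : Computable id
id-computable = emit kᴱ , λ k → let open Machine (k ∷ []) in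
  _ , runs⇒within {m = 0} (emit-runs kᴱ)

length≤bitLength : ∀ ws → length ws ≤ bitLength ws
length≤bitLength []       = z≤n
length≤bitLength (_ ∷ ws) = s≤s (≤-trans (length≤bitLength ws) (m≤n+m _ _))

-- The second summand is nonzero only if T = 0 < k, where it makes the cut
-- impossible although the truncated T ∸ (k + k * k) is 0.
cutSize : (k T : ℕ) → ℕ
cutSize k T = (T ∸ (k + k * k)) + (k ∸ T)

blocks : (n k : ℕ) → ℕ
blocks n k = n * suc (n + suc (k + k * k))

cutSize-+ : ∀ n k → k ≤ blocks n k → cutSize k (blocks n k) + (k + k * k) ≡ blocks n k
cutSize-+ zero zero    _ = refl
cutSize-+ n@(suc m) k k≤T = begin
  (T ∸ (k + k * k)) + (k ∸ T) + (k + k * k)  ≡⟨ cong (λ z → (T ∸ (k + k * k)) + z + (k + k * k)) (m≤n⇒m∸n≡0 k≤T) ⟩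
  (T ∸ (k + k * k)) + 0 + (k + k * k)        ≡⟨ cong (_+ (k + k * k)) (+-identityʳ (T ∸ (k + k * k))) ⟩
  (T ∸ (k + k * k)) + (k + k * k)            ≡⟨ m∸n+n≡m enough ⟩
  T                                          ∎
  where
  open ≡-Reasoning
  T = blocks n k
  enough : k + k * k ≤ T
  enough = ≤-trans (≤-trans (≤-trans (n≤1+n _) (m≤n+m _ n)) (n≤1+n _)) (m≤m+n _ _)

n≤blocks : ∀ n k → n ≤ blocks n k
n≤blocks n k = m≤m*n n (suc (n + suc (k + k * k)))

-- Without vertices the cut size is `k` itself; with at least one vertex a single block already has
-- more than `k` items.
cutSize≤⇒k≤ : ∀ n k → cutSize k (blocks n k) ≤ blocks n k → k ≤ blocks n k
cutSize≤⇒k≤ zero    k le = ≤-trans (m≤n+m k _) le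
cutSize≤⇒k≤ n@(suc m) k _ = ≤-trans (≤-trans (≤-trans (m≤m+n k (k * k))
  (≤-trans (n≤1+n _) (m≤n+m _ n))) (n≤1+n _)) (m≤m+n _ _)

-- The reduction obtained from a layout

module FromLayout {t : ℕ} (layout : Layout t) where
  open Layout layout

  -- Six words per track, namely sign, numerator and denominator of both endpoints, and the closing
  -- `skip`.
  itemTime : ℕ
  itemTime = 1 + t * 6

  track : Kind → Fin t → List Expr
  track κ i = lit 0 ∷ loᴱ κ i ∷ lit 1 ∷ lit 0 ∷ (loᴱ κ i ⊕ lenᴱ κ) ∷ lit 1 ∷ []

  emitItem : Kind → Program
  emitItem κ = emits (concat (tabulate (track κ)))

  -- Nonzero exactly for good pairs: the offset 2 skips `k` and `n` in front of the matrix, and 1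
  -- truncated by the distance of `u` and `v` survives only if they are equal.
  pairCondition : Expr
  pairCondition = input (lit 2 ⊕ var 7) ⊕ (lit 1 ⊖ ((uᴱ ⊖ vᴱ) ⊕ (vᴱ ⊖ uᴱ)))

  emitPair emitBlock program : Program
  emitPair  = ifnz pairCondition then emitItem edge else emitItem filler
  emitBlock =
    emitItem vertex ⨟ 8 ≔ lit 1 ⊕ var 8 ⨟
    (whilenz nᴱ ⊖ var 5 loop
      (emitPair ⨟ 5 ≔ lit 1 ⊕ var 5 ⨟ 6 ≔ Dᴱ ⊕ var 6 ⨟ 7 ≔ lit 1 ⊕ var 7 ⨟ 8 ≔ lit 1 ⊕ var 8)) ⨟
    -- Register 7 is not reset here: at the end of a row it already points to the start of the next
    -- one.
    5 ≔ lit 0 ⨟ 6 ≔ lit 0 ⨟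
    (whilenz Nᴱ ⊖ var 0 loop
      (emitItem filler ⨟ 0 ≔ lit 1 ⊕ var 0 ⨟ 8 ≔ lit 1 ⊕ var 8)) ⨟
    0 ≔ lit 0 ⨟ 3 ≔ lit 1 ⊕ var 3 ⨟ 4 ≔ Dᴱ ⊕ var 4
  program =
    square ⨟ total ⨟
    emit kᴱ ⨟ emit ((Tᴱ ⊖ (kᴱ ⊕ var 1)) ⊕ (kᴱ ⊖ Tᴱ)) ⨟ emit Tᴱ ⨟
    (whilenz nᴱ ⊖ var 3 loop emitBlock)

  module At (x : CliqueInstance) where
    open CliqueInstance x public

    n N M T D : ℕ
    n = order graph
    N = suc (k + k * k)
    M = suc (n + N)
    T = n * M
    D = n + (T + 2)

    good? : ∀ u v → Dec (Good graph u v)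
    good? u v = (u ≟ v) ⊎-dec adj? u v

    word : Fin n → Fin n → ℕ
    word u v = if does (adj? u v) then 1 else 0

    xs : List ℕ
    xs = ParameterizedProblem.encode k-Clique x

    open Machine xs public

    regs : (i u v p q : ℕ) → List ℕ
    regs i u v p q = i ∷ k * k ∷ T ∷ u ∷ u * D ∷ v ∷ v * D ∷ p ∷ q ∷ []

    pairKind : ∀ {u v} → Dec (Good graph u v) → Kind
    pairKind (yes _) = edge
    pairKind (no _)  = filler

    kind : Item n N → Kind
    kind (vtx u)    = vertex
    kind (pair u v) = pairKind (good? u v)
    kind (hub u i)  = filler

    -- The contents of the registers when an item is emitted; the last one
    -- counts the items emitted before.
    vertexRegs : ℕ → List ℕ
    vertexRegs u = regs 0 u 0 (u * n) (u * M)

    pairRegs hubRegs : ℕ → ℕ → List ℕ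
    pairRegs u v = regs 0 u v (v + u * n) (v + suc (u * M))
    hubRegs u i  = regs i u 0 (n + u * n) (i + (n + suc (u * M)))

    itemRegs : Item n N → List ℕ
    itemRegs (vtx u)    = vertexRegs (toℕ u)
    itemRegs (pair u v) = pairRegs (toℕ u) (toℕ v)
    itemRegs (hub u i)  = hubRegs (toℕ u) (toℕ i)

    loAs : Kind → Item n N → Fin t → ℕ
    loAs κ a i = val (loᴱ κ i) (itemRegs a)

    lenAs : Kind → Item n N → ℕ
    lenAs κ a = val (lenᴱ κ) (itemRegs a)

    itemLo : Item n N → Fin t → ℕ
    itemLo a = loAs (kind a) a

    itemLen : Item n N → ℕ
    itemLen a = lenAs (kind a) a

    family : Family t
    family = ℕ-family T (itemLo ∘ itemAt) (itemLen ∘ itemAt)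

    code : Kind → List ℕ → List ℕ
    code κ ρ = concat (tabulate λ i →
      let lo = val (loᴱ κ i) ρ in 0 ∷ lo ∷ 1 ∷ 0 ∷ lo + val (lenᴱ κ) ρ ∷ 1 ∷ [])

    itemCode : Item n N → List ℕ
    itemCode a = code (kind a) (itemRegs a)

    blockCode : Fin n → List ℕ
    blockCode u = itemCode (vtx u) ++
      concat (tabulate λ v → itemCode (pair u v)) ++ concat (tabulate λ i → itemCode (hub u i))

    encodeFamily-family : encodeFamily family ≡ T ∷ concat (tabulate blockCode)
    encodeFamily-family = cong (T ∷_) (begin
      _  ≡⟨ concatMap-allFin {m = T} _ ⟩
      _  ≡⟨ concat-tabulate-cong {m = T} (λ y → concatMap-allFin {m = t} _) ⟩
      concat (tabulate (itemCode ∘ itemAt))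
         ≡⟨ concat-tabulate-* n M (itemCode ∘ itemAt) ⟩
      concat (tabulate {n = n} λ u → concat (tabulate {n = M} λ j → itemCode (itemAt (combine u j))))
         ≡⟨ concat-tabulate-cong (λ u → cong₂ _++_
              (cong itemCode (itemAt-index (vtx u)))
              (trans (concat-tabulate-+ n N _) (cong₂ _++_
                (concat-tabulate-cong (λ v → cong itemCode (itemAt-index (pair u v))))
                (concat-tabulate-cong (λ i → cong itemCode (itemAt-index (hub u i))))))) ⟩
      concat (tabulate blockCode) ∎)
      where open ≡-Reasoning

    -- Register 8 holds the number of the current item, which a layout may use as an identifier of
    -- that item.
    toℕ-index : ∀ a → toℕ (itemIndex a) ≡ val qᴱ (itemRegs a)
    toℕ-index (vtx u) = trans (toℕ-combine u zero) (trans (+-identityʳ _) (*-comm M (toℕ u)))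
    toℕ-index (pair u v) = begin
      toℕ (combine u (suc (v ↑ˡ N)))     ≡⟨ toℕ-combine u (suc (v ↑ˡ N)) ⟩
      M * toℕ u + suc (toℕ (v ↑ˡ N))     ≡⟨ cong (λ z → M * toℕ u + suc z) (toℕ-↑ˡ v N) ⟩
      M * toℕ u + suc (toℕ v)            ≡⟨ +-suc _ _ ⟩
      suc (M * toℕ u) + toℕ v            ≡⟨ +-comm _ (toℕ v) ⟩
      toℕ v + suc (M * toℕ u)            ≡⟨ cong (λ z → toℕ v + suc z) (*-comm M (toℕ u)) ⟩
      toℕ v + suc (toℕ u * M)            ∎
      where open ≡-Reasoning
    toℕ-index (hub u i) = begin
      toℕ (combine u (suc (n ↑ʳ i)))     ≡⟨ toℕ-combine u (suc (n ↑ʳ i)) ⟩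
      M * toℕ u + suc (toℕ (n ↑ʳ i))     ≡⟨ cong₂ (λ y z → y + suc z) (*-comm M (toℕ u)) (toℕ-↑ʳ n i) ⟩
      toℕ u * M + suc (n + toℕ i)        ≡⟨ solve 3 (λ a n i → a :+ (con 1 :+ (n :+ i)) := i :+ (n :+ (con 1 :+ a)))
                                              refl (toℕ u * M) n (toℕ i) ⟩
      toℕ i + (n + suc (toℕ u * M))      ∎
      where
      open ≡-Reasoning
      open +-*-Solver

    xs-matrix : xs ≡ k ∷ n ∷ concat (tabulate (tabulate ∘ word))
    xs-matrix = cong (λ ws → k ∷ n ∷ ws) (trans (concatMap-allFin {m = n} _)
      (concat-tabulate-cong (λ u → map-tabulate id (word u))))

    val-pairCondition : ∀ u v → val pairCondition (pairRegs (toℕ u) (toℕ v)) ≡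
      word u v + (1 ∸ ((toℕ u ∸ toℕ v) + (toℕ v ∸ toℕ u)))
    val-pairCondition u v = cong (_+ (1 ∸ ((toℕ u ∸ toℕ v) + (toℕ v ∸ toℕ u))))
      (trans (cong (λ ws → wordAt ws (2 + (toℕ v + toℕ u * n))) xs-matrix) (wordAt-matrix word u v))

    kind-hub : ∀ a → IsHub graph a → kind a ≡ filler
    kind-hub (hub u i)  _  = refl
    kind-hub (pair u v) ¬g with good? u v
    ... | yes g = contradiction g ¬g
    ... | no _  = refl

    kind-good : ∀ u v → Good graph u v → kind (pair u v) ≡ edge
    kind-good u v g with good? u v
    ... | yes _ = refl
    ... | no ¬g = contradiction g ¬g

    -- The kinds are separate arguments because `kind (pair u v)` is stuck on the decision
    -- `good? u v`; they are tied to the items by equations below.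
    MeetAs : Item n N → Kind → Item n N → Kind → Set
    MeetAs a κ b μ = ∃[ i ] Meet (loAs κ a i) (lenAs κ a) (loAs μ b i) (lenAs μ b)

    private
      index-injective : ∀ (a b : Item n N) → itemIndex a ≡ itemIndex b → a ≡ b
      index-injective a b eq = trans (sym (itemAt-index a)) (trans (cong itemAt eq) (itemAt-index b))

      Meets-family : Fin T → Fin T → Set
      Meets-family = Meets T (itemLo ∘ itemAt) (itemLen ∘ itemAt)

      meetAs⇒meets : ∀ a b {κ μ} → kind a ≡ κ → kind b ≡ μ → MeetAs a κ b μ →
        Meets-family (itemIndex a) (itemIndex b)
      meetAs⇒meets a b refl refl = subst₂ (λ a′ b′ → MeetAs a′ (kind a′) b′ (kind b′))
        (sym (itemAt-index a)) (sym (itemAt-index b))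

      meets⇒meetAs : ∀ a b {κ μ} → kind a ≡ κ → kind b ≡ μ →
        Meets-family (itemIndex a) (itemIndex b) → MeetAs a κ b μ
      meets⇒meetAs a b refl refl = subst₂ (λ a′ b′ → MeetAs a′ (kind a′) b′ (kind b′))
        (itemAt-index a) (itemAt-index b)

    meet⇒adj : ∀ a b {κ μ} → kind a ≡ κ → kind b ≡ μ → a ≢ b → MeetAs a κ b μ →
      Adj (intersectionGraph family) (itemIndex a) (itemIndex b)
    meet⇒adj a b p q a≢b m = meets⇒adj T (itemLo ∘ itemAt) (itemLen ∘ itemAt)
      (a≢b ∘ index-injective a b) (meetAs⇒meets a b p q m)

    adj⇒meet : ∀ a b {κ μ} → kind a ≡ κ → kind b ≡ μ →
      Adj (intersectionGraph family) (itemIndex a) (itemIndex b) → a ≢ b × MeetAs a κ b μ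
    adj⇒meet a b p q e = proj₁ e ∘ cong itemIndex ,
      meets⇒meetAs a b p q (adj⇒meets T (itemLo ∘ itemAt) (itemLen ∘ itemAt) e)

    ¬meet⇒co-adj : ∀ a b {κ μ} → kind a ≡ κ → kind b ≡ μ → a ≢ b → ¬ MeetAs a κ b μ →
      Adj (complement (intersectionGraph family)) (itemIndex a) (itemIndex b)
    ¬meet⇒co-adj a b p q a≢b ¬m =
      a≢b ∘ index-injective a b , λ e → ¬m (proj₂ (adj⇒meet a b p q e))

    co-adj⇒¬meet : ∀ a b {κ μ} → kind a ≡ κ → kind b ≡ μ →
      Adj (complement (intersectionGraph family)) (itemIndex a) (itemIndex b) → ¬ MeetAs a κ b μ
    co-adj⇒¬meet a b p q (x≢y , ¬e) m = ¬e (meet⇒adj a b p q (x≢y ∘ cong itemIndex) m)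

    emitItem-runs : ∀ κ {ρ} → Runs (emitItem κ) ρ itemTime ρ (code κ ρ)
    emitItem-runs κ {ρ} = subst₂ (λ l ws → Runs (emitItem κ) ρ (1 + l) ρ ws)
      (length-concat-tabulate (track κ) (λ _ → refl))
      (trans (sym (concat-map (tabulate (track κ)))) (cong concat (map-tabulate (track κ) (map _))))
      (emits-runs _)

    emitPair-runs : ∀ u v → (d : Dec (Good graph u v)) → let ρ = pairRegs (toℕ u) (toℕ v) in
      Runs emitPair ρ (1 + itemTime) ρ (code (pairKind d) ρ)
    emitPair-runs u v d@(yes good) = if-nonzero-runs (λ eq → nonzero-value good (trans (sym (val-pairCondition u v)) eq)) (emitItem-runs edge)
      where
      nonzero-value : Good graph u v → word u v + (1 ∸ ((toℕ u ∸ toℕ v) + (toℕ v ∸ toℕ u))) ≢ 0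
      nonzero-value (inj₁ refl) eq with m+n≡0⇒n≡0 (word u v) eq
      ... | z rewrite n∸n≡0 (toℕ u) = case z of λ ()
      nonzero-value (inj₂ e) eq with m+n≡0⇒m≡0 (word u v) eq
      ... | z rewrite dec-true (adj? u v) e = case z of λ ()
    emitPair-runs u v (no ¬good) = if-zero-runs (trans (val-pairCondition u v) zero-value) (emitItem-runs filler)
      where
      apart : 1 ≤ (toℕ u ∸ toℕ v) + (toℕ v ∸ toℕ u)
      apart = n≢0⇒n>0 λ eq → ¬good (inj₁ (toℕ-injective (≤-antisym
        (m∸n≡0⇒m≤n (m+n≡0⇒m≡0 _ eq)) (m∸n≡0⇒m≤n (m+n≡0⇒n≡0 (toℕ u ∸ toℕ v) eq)))))
      zero-value : word u v + (1 ∸ ((toℕ u ∸ toℕ v) + (toℕ v ∸ toℕ u))) ≡ 0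
      zero-value rewrite dec-false (adj? u v) (¬good ∘ inj₂) = m≤n⇒m∸n≡0 apart

    blockTime : ℕ
    blockTime = itemTime + (1 + ((1 + n * (1 + ((1 + itemTime) + 4))) + (1 + (1 + ((1 + N * (1 + (itemTime + 2))) + 3)))))

    emitBlock-runs : ∀ u → let u′ = toℕ u in
      Runs emitBlock (vertexRegs u′) blockTime (vertexRegs (suc u′)) (blockCode u)
    emitBlock-runs u = subst₂ (Runs emitBlock _ _)
      -- All other registers already match by computation; only the item counter needs arithmetic.
      (cong (regs 0 (suc u′) 0 (n + u′ * n)) next)
      (cong (itemCode (vtx u) ++_) (cong (concat (tabulate (λ v → itemCode (pair u v))) ++_) (++-identityʳ _)))
      (emitItem-runs vertex ⨟-runs assign-runs 8 (lit 1 ⊕ var 8) ⨟-runs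
       loop-runs n (pairRegs u′) (λ v → itemCode (pair u v)) n∸toℕ≢0 (n∸n≡0 n)
         (λ v → subst (Runs _ _ _ _) (++-identityʳ _)
           (emitPair-runs u v (good? u v) ⨟-runs assign-runs 5 (lit 1 ⊕ var 5) ⨟-runs
            assign-runs 6 (Dᴱ ⊕ var 6) ⨟-runs assign-runs 7 (lit 1 ⊕ var 7) ⨟-runs
            assign-runs 8 (lit 1 ⊕ var 8))) ⨟-runs
       assign-runs 5 (lit 0) ⨟-runs assign-runs 6 (lit 0) ⨟-runs
       loop-runs N (hubRegs u′) (λ i → itemCode (hub u i)) n∸toℕ≢0 (n∸n≡0 N)
         (λ i → subst (Runs _ _ _ _) (++-identityʳ _)
           (emitItem-runs filler ⨟-runs assign-runs 0 (lit 1 ⊕ var 0) ⨟-runs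
            assign-runs 8 (lit 1 ⊕ var 8))) ⨟-runs
       assign-runs 0 (lit 0) ⨟-runs assign-runs 3 (lit 1 ⊕ var 3) ⨟-runs assign-runs 4 (Dᴱ ⊕ var 4))
      where
      u′ = toℕ u
      next : N + (n + suc (u′ * M)) ≡ M + u′ * M
      next = solve 3 (λ N n a → N :+ (n :+ (con 1 :+ a)) := con 1 :+ (n :+ N) :+ a) refl N n (u′ * M)
        where open +-*-Solver

    total-runs : Runs total (0 ∷ k * k ∷ 0 ∷ 0 ∷ 0 ∷ 0 ∷ 0 ∷ 0 ∷ 0 ∷ []) (1 + n * 3 + 1) (vertexRegs 0) []
    total-runs = subst (Runs _ _ _ _) (trans (++-identityʳ _) (concat-tabulate-[] n))
      (loop-runs n (λ j → j ∷ k * k ∷ j * M ∷ 0 ∷ 0 ∷ 0 ∷ 0 ∷ 0 ∷ 0 ∷ []) (λ _ → []) n∸toℕ≢0 (n∸n≡0 n)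
        (λ _ → assign-runs 2 ((lit 1 ⊕ (nᴱ ⊕ Nᴱ)) ⊕ var 2) ⨟-runs assign-runs 0 (lit 1 ⊕ var 0))
       ⨟-runs assign-runs 0 (lit 0))

    time : ℕ
    time = (1 + k * 3 + 1) + ((1 + n * 3 + 1) + (1 + (1 + (1 + (1 + n * (1 + blockTime))))))

    program-runs : Within program xs (k ∷ cutSize k T ∷ encodeFamily family) time
    program-runs = runs⇒within {m = 9} (subst (Runs _ _ _ _)
      (cong (λ ws → k ∷ cutSize k T ∷ ws) (sym encodeFamily-family))
      (square-runs k _ ⨟-runs total-runs ⨟-runs emit-runs kᴱ ⨟-runs
       emit-runs ((Tᴱ ⊖ (kᴱ ⊕ var 1)) ⊕ (kᴱ ⊖ Tᴱ)) ⨟-runs emit-runs Tᴱ ⨟-runs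
       loop-runs n vertexRegs blockCode n∸toℕ≢0 (n∸n≡0 n) emitBlock-runs))

    -- Each monomial is at most `Z = N * (b * b)`: the matrix has `n * n` entries, so `n * n ≤ b`,
    -- and `k ≤ N`. The constant `32 + 3 * itemTime` is the sum of the coefficients, and `N` depends
    -- on `k` alone, so it goes into `g`.
    time≤ : time ≤ ((32 + 3 * itemTime) * N) * bitLength xs ^ 2
    time≤ = begin
      time
        ≡⟨ solve 4 (λ k n N E →
             (con 1 :+ k :* con 3 :+ con 1) :+ ((con 1 :+ n :* con 3 :+ con 1) :+ (con 1 :+ (con 1 :+ (con 1 :+ (con 1 :+ n :* (con 1 :+
               (E :+ (con 1 :+ ((con 1 :+ n :* (con 1 :+ ((con 1 :+ E) :+ con 4))) :+
                (con 1 :+ (con 1 :+ ((con 1 :+ N :* (con 1 :+ (E :+ con 2))) :+ con 3)))))))))))) :=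
             con 8 :+ con 3 :* k :+ (con 12 :+ E) :* n :+ (con 6 :+ E) :* (n :* n) :+ (con 3 :+ E) :* (n :* N))
             refl k n N itemTime ⟩
      8 + 3 * k + (12 + itemTime) * n + (6 + itemTime) * (n * n) + (3 + itemTime) * (n * N)
        ≤⟨ +-mono-≤ (+-mono-≤ (+-mono-≤ (+-mono-≤ (*-monoʳ-≤ 8 1≤Z) (*-monoʳ-≤ 3 k≤Z))
             (*-monoʳ-≤ (12 + itemTime) n≤Z)) (*-monoʳ-≤ (6 + itemTime) nn≤Z)) (*-monoʳ-≤ (3 + itemTime) nN≤Z) ⟩
      8 * Z + 3 * Z + (12 + itemTime) * Z + (6 + itemTime) * Z + (3 + itemTime) * Z
        ≡⟨ solve 3 (λ E N b → let Z = N :* (b :* b) in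
             con 8 :* Z :+ con 3 :* Z :+ (con 12 :+ E) :* Z :+ (con 6 :+ E) :* Z :+ (con 3 :+ E) :* Z :=
             ((con 32 :+ con 3 :* E) :* N) :* (b :* (b :* con 1))) refl itemTime N b ⟩
      ((32 + 3 * itemTime) * N) * b ^ 2 ∎
      where
      open ≤-Reasoning
      open +-*-Solver
      b = bitLength xs
      Z = N * (b * b)
      2+nn≤b : 2 + n * n ≤ b
      2+nn≤b = ≤-trans (≤-reflexive (sym (trans (cong length xs-matrix)
        (cong (2 +_) (length-concat-tabulate (tabulate ∘ word) (λ u → length-tabulate (word u))))))) (length≤bitLength xs)
      m≤m*m : ∀ m → m ≤ m * m
      m≤m*m zero      = z≤n
      m≤m*m m@(suc _) = m≤m*n m m
      1≤b : 1 ≤ b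
      1≤b = ≤-trans (s≤s z≤n) 2+nn≤b
      n≤b : n ≤ b
      n≤b = ≤-trans (≤-trans (m≤m*m n) (m≤n+m _ 2)) 2+nn≤b
      bb≤Z : b * b ≤ Z
      bb≤Z = m≤m+n (b * b) _
      1≤Z : 1 ≤ Z
      1≤Z = ≤-trans (*-mono-≤ 1≤b 1≤b) bb≤Z
      n≤Z : n ≤ Z
      n≤Z = ≤-trans n≤b (≤-trans (m≤m*m b) bb≤Z)
      nn≤Z : n * n ≤ Z
      nn≤Z = ≤-trans (*-mono-≤ n≤b n≤b) bb≤Z
      nN≤Z : n * N ≤ Z
      nN≤Z = ≤-trans (≤-reflexive (*-comm n N)) (*-monoʳ-≤ N (≤-trans n≤b (m≤m*m b)))
      k≤Z : k ≤ Z
      k≤Z = ≤-trans (≤-trans (m≤m+n k (k * k)) (n≤1+n _))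
        (≤-trans (≤-reflexive (sym (*-identityʳ N))) (*-monoʳ-≤ N (*-mono-≤ 1≤b 1≤b)))

  reduction : (graphOf : Family t → Graph) → (∀ F → order (graphOf F) ≡ Family.size F) →
    (∀ x → let open At x in Gadget graph N (graphOf family)) →
    FPTReduction k-Clique (CuttingConnectedOn graphOf)
  reduction graphOf order-graphOf gadget = record
    { transform    = λ x → let open At x in
        record { representation = family ; k = k ; l = cutSize k T }
    ; equivalent   = equivalent
    ; g            = λ k → (32 + 3 * itemTime) * suc (k + k * k)
    ; h            = id
    ; g-computable = scale-computable (32 + 3 * itemTime)
    ; h-computable = id-computable
    ; parameter-≤  = λ _ → ≤-refl
    ; program      = program
    ; exponent     = 2
    ; runs         = program-within
    }
    where
    program-within : ∀ x → let open At x in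
      Within program xs (k ∷ cutSize k T ∷ encodeFamily family) (((32 + 3 * itemTime) * N) * bitLength xs ^ 2)
    program-within x = let s , t , run , out , le = program-runs in s , t , run , out , ≤-trans le time≤
      where open At x

    -- Each side yields `k ≤ T`, under which `l` has the intended value: a clique has at most `n`
    -- elements, and `X` must fit among the `T` items.
    equivalent : ∀ x → let open At x in
      ParameterizedProblem.Yes k-Clique x ⇔ HasCut (graphOf family) k (cutSize k T)
    equivalent x = mk⇔
      (λ yes@(C , ∣C∣ , _) → clique⇒cut x (gadget x)
        (size (≤-trans (subst (_≤ n) ∣C∣ (∣p∣≤n C)) (n≤blocks n k))) yes)
      (λ cut@(X , _ , _ , _ , ∣X∣ , _) → cut⇒clique x (gadget x)
        (size (cutSize≤⇒k≤ n k (subst₂ _≤_ ∣X∣ (order-graphOf family) (∣p∣≤n X)))) cut)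
      where
      open At x
      size : k ≤ T → cutSize k T + (k + k * k) ≡ order (graphOf family)
      size k≤T = trans (cutSize-+ n k k≤T) (sym (order-graphOf family))

-- The two representations

quotient-≤ : ∀ {D} a b {s} → s < D → a * D ≤ b * D + s → a ≤ b
quotient-≤ {D} a b {s} s<D le with a ≤? b
... | yes a≤b = a≤b
... | no a≰b  = contradiction (begin-strict
  a * D       ≤⟨ le ⟩
  b * D + s   <⟨ +-monoʳ-< (b * D) s<D ⟩
  b * D + D   ≡⟨ +-comm (b * D) D ⟩
  suc b * D   ≤⟨ *-monoˡ-≤ D (≰⇒> a≰b) ⟩
  a * D       ∎) (<-irrefl refl)
  where open ≤-Reasoning

quotient-unique : ∀ {D} a b {r s} → r < D → s < D → a * D + r ≡ b * D + s → a ≡ b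
quotient-unique a b r<D s<D eq = ≤-antisym
  (quotient-≤ a b s<D (≤-trans (m≤m+n _ _) (≤-reflexive eq)))
  (quotient-≤ b a r<D (≤-trans (m≤m+n _ _) (≤-reflexive (sym eq))))

points-meet : ∀ {a b} → Meet a 0 b 0 → a ≡ b
points-meet {a} {b} (p , q) =
  ≤-antisym (subst (a ≤_) (+-identityʳ b) p) (subst (b ≤_) (+-identityʳ a) q)

-- All fillers meet at the point n of the second track.  Within the blocks
-- [uD, uD + D), the pairs use only the offsets below n, each point for at most
-- one pair, and on the two tracks they lie in the blocks of their two ends.
twoTracks : Layout 2
twoTracks = record { loᴱ = start ; lenᴱ = extent }
  where
  start : Kind → Fin 2 → Expr
  start vertex _          = uDᴱ
  start edge   zero       = uDᴱ ⊕ vᴱ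
  start edge   (suc zero) = vDᴱ ⊕ uᴱ
  start filler zero       = uDᴱ ⊕ nᴱ
  start filler (suc zero) = nᴱ
  extent : Kind → Expr
  extent vertex = nᴱ
  extent edge   = lit 0
  extent filler = lit 0

module _ where
  open FromLayout twoTracks

  twoTracks-gadget : ∀ x → let open At x in Gadget graph N (intersectionGraph family)
  twoTracks-gadget x = record
    { item       = itemAt
    ; index      = itemIndex
    ; item-index = itemAt-index
    ; index-item = itemIndex-at {n} {N}
    ; hub-hub    = λ a b p q a≢b → meet⇒adj a b (kind-hub a p) (kind-hub b q) a≢b
                     (suc zero , m≤m+n n 0 , m≤m+n n 0)
    ; vtx-hub    = λ u i → meet⇒adj (vtx u) (hub u i) refl refl (λ ())
                     (zero , ≤-trans (m≤m+n _ n) (m≤m+n _ 0) , ≤-refl)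
    ; pair-fst   = λ u v g → meet⇒adj (pair u v) (vtx u) (kind-good u v g) refl (λ ())
                     (zero , +-monoʳ-≤ (toℕ u * D) (<⇒≤ (toℕ<n v)) , ≤-trans (m≤m+n _ (toℕ v)) (m≤m+n _ 0))
    ; pair-snd   = λ u v g → meet⇒adj (pair u v) (vtx v) (kind-good u v g) refl (λ ())
                     (suc zero , +-monoʳ-≤ (toℕ v * D) (<⇒≤ (toℕ<n u)) , ≤-trans (m≤m+n _ (toℕ u)) (m≤m+n _ 0))
    ; pair-only  = pair-only
    }
    where
    open At x

    n<D : n < D
    n<D = ≤-trans (≤-reflexive (+-comm 1 n)) (+-monoʳ-≤ n (≤-trans (s≤s z≤n) (m≤n+m 2 T)))

    u<D : (u : Fin n) → toℕ u < D
    u<D u = <-trans (toℕ<n u) n<D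

    block-vertex : ∀ (u v w : Fin n) → Meet (toℕ u * D + toℕ v) 0 (toℕ w * D) n → w ≡ u
    block-vertex u v w (p , q) = toℕ-injective (≤-antisym
      (quotient-≤ (toℕ w) (toℕ u) (u<D v) (subst (toℕ w * D ≤_) (+-identityʳ _) q))
      (quotient-≤ (toℕ u) (toℕ w) n<D (≤-trans (m≤m+n _ _) p)))

    block-pair : ∀ (u v u′ v′ : Fin n) → Meet (toℕ u * D + toℕ v) 0 (toℕ u′ * D + toℕ v′) 0 →
      u ≡ u′ × v ≡ v′
    block-pair u v u′ v′ m
      with refl ← toℕ-injective (quotient-unique (toℕ u) (toℕ u′) (u<D v) (u<D v′) (points-meet m)) =
      refl , toℕ-injective (+-cancelˡ-≡ (toℕ u * D) _ _ (points-meet m))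

    -- The offsets within a block differ: `n` for the filler, less than `n` for the pair.
    block-hub : ∀ (u v : Fin n) w → Meet (toℕ u * D + toℕ v) 0 (w * D + n) 0 → ⊥
    block-hub u v w m
      with refl ← quotient-unique (toℕ u) w (u<D v) n<D (points-meet m) =
      <⇒≢ (toℕ<n v) (+-cancelˡ-≡ (w * D) _ _ (points-meet m))

    pair-hub : ∀ {u v b} → Good graph u v → IsHub graph b → (loAs filler b zero ≡ toℕ (fst b) * D + n) →
      ¬ Adj (intersectionGraph family) (itemIndex (pair u v)) (itemIndex b)
    pair-hub {u} {v} {b} g h at e with adj⇒meet (pair u v) b (kind-good u v g) (kind-hub b h) e
    ... | _ , zero , m     = block-hub u v (toℕ (fst b)) (subst (λ c → Meet (toℕ u * D + toℕ v) 0 c 0) at m)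
    -- The common point `n` of the fillers is offset `n` in block 0.
    ... | _ , suc zero , m = block-hub v u 0 m

    pair-only : ∀ u v b → Good graph u v →
      Adj (intersectionGraph family) (itemIndex (pair u v)) (itemIndex b) → b ≡ vtx u ⊎ b ≡ vtx v
    pair-only u v (vtx w) g e with adj⇒meet (pair u v) (vtx w) (kind-good u v g) refl e
    ... | _ , zero     , m = inj₁ (cong vtx (block-vertex u v w m))
    ... | _ , suc zero , m = inj₂ (cong vtx (block-vertex v u w m))
    pair-only u v b@(hub _ _) g e = contradiction e (pair-hub {b = b} g _ refl)
    pair-only u v b@(pair u′ v′) g e with good? u′ v′
    ... | no ¬g = contradiction e (pair-hub {b = b} g ¬g refl)
    ... | yes g′ with adj⇒meet (pair u v) b (kind-good u v g) (kind-good u′ v′ g′) e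
    ...   | a≢b , zero , m     = contradiction (uncurry (cong₂ pair) (block-pair u v u′ v′ m)) a≢b
    ...   | a≢b , suc zero , m = contradiction (uncurry (λ p q → cong₂ pair q p) (block-pair v u v′ u′ m)) a≢b

-- A good pair with ends a ≤ b meets exactly the vertices w ∉ {a, b}: w < a on
-- the first track, where the order is reversed, a < w < b on the second, where
-- vertex w is the point wD, and w > b on the third.  On the second track it
-- fills [aD + 1, bD - 1], or [aD + 1, aD + D - 1] if a = b; as D = n + T + 2,
-- an interval of this length passes all fillers on the first track.
threeTracks : Layout 3
threeTracks = record { loᴱ = start ; lenᴱ = extent }
  where
  start : Kind → Fin 3 → Expr
  start vertex zero             = nᴱ ⊖ uᴱ
  start vertex (suc zero)       = uDᴱ
  start vertex (suc (suc zero)) = uᴱ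
  -- The nested subtractions compute minima, here and on the next track, and `uᴱ ⊕ (vᴱ ⊖ uᴱ)` is the
  -- maximum.
  start edge   zero             = lit 1 ⊕ (nᴱ ⊖ (uᴱ ⊖ (uᴱ ⊖ vᴱ)))
  start edge   (suc zero)       = lit 1 ⊕ (uDᴱ ⊖ (uDᴱ ⊖ vDᴱ))
  start edge   (suc (suc zero)) = lit 1 ⊕ (uᴱ ⊕ (vᴱ ⊖ uᴱ))
  start filler _                = lit 1 ⊕ (nᴱ ⊕ qᴱ)
  extent : Kind → Expr
  extent vertex = lit 0
  -- For ends a < b this is (b - a)D - 2; for a = b the outer subtraction truncates and n + T = D -
  -- 2 remains.
  extent edge   = (nᴱ ⊕ Tᴱ) ⊕ (((uDᴱ ⊖ vDᴱ) ⊕ (vDᴱ ⊖ uDᴱ)) ⊖ Dᴱ)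
  extent filler = lit 0

-- Arithmetic of the intervals on three tracks

module ThreeTracks (n T : ℕ) where

  D : ℕ
  D = n + (T + 2)

  vertexLo : ℕ → Fin 3 → ℕ
  vertexLo w zero             = n ∸ w
  vertexLo w (suc zero)       = w * D
  vertexLo w (suc (suc zero)) = w

  edgeLo : (a b : ℕ) → Fin 3 → ℕ
  edgeLo a b zero             = 1 + (n ∸ a)
  edgeLo a b (suc zero)       = 1 + a * D
  edgeLo a b (suc (suc zero)) = 1 + b

  edgeLen : (a b : ℕ) → ℕ
  edgeLen a b = (n + T) + ((b * D ∸ a * D) ∸ D)

  n≤edgeLen : ∀ a b → n ≤ edgeLen a b
  n≤edgeLen a b = ≤-trans (m≤m+n n T) (m≤m+n _ _)

  Meet₃ : (Fin 3 → ℕ) → ℕ → (Fin 3 → ℕ) → ℕ → Set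
  Meet₃ lo k lo′ k′ = ∃[ i ] Meet (lo i) k (lo′ i) k′

  edge-end : ∀ {a b} → a < b → suc (1 + a * D + edgeLen a b) ≡ b * D
  edge-end {a} {b} a<b = begin
    suc (1 + a * D + edgeLen a b)            ≡⟨ cong (λ z → suc (1 + a * D + ((n + T) + z))) (∸-+-assoc (b * D) (a * D) D) ⟩
    suc (1 + a * D + ((n + T) + e))          ≡⟨ solve 4 (λ x n T e →
                                                  con 1 :+ (con 1 :+ x :+ ((n :+ T) :+ e)) :=
                                                  (x :+ (n :+ (T :+ con 2))) :+ e) refl (a * D) n T e ⟩
    (a * D + D) + e                          ≡⟨ m+[n∸m]≡n (≤-trans (≤-reflexive (+-comm (a * D) D)) (*-monoˡ-≤ D a<b)) ⟩
    b * D                                    ∎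
    where
    open ≡-Reasoning
    open +-*-Solver
    e = b * D ∸ (a * D + D)

  -- On the first two tracks the interval starts one past the vertex, and on the third it starts at
  -- `1 + b`, beyond `a`.
  edge-avoids-low : ∀ {a b} → a ≤ b → ¬ Meet₃ (edgeLo a b) (edgeLen a b) (vertexLo a) 0
  edge-avoids-low a≤b (zero , p , _)             = 1+n≰n (≤-trans p (≤-reflexive (+-identityʳ _)))
  edge-avoids-low a≤b (suc zero , p , _)         = 1+n≰n (≤-trans p (≤-reflexive (+-identityʳ _)))
  edge-avoids-low a≤b (suc (suc zero) , p , _)   = 1+n≰n (≤-trans (≤-trans p (≤-reflexive (+-identityʳ _))) a≤b)

  -- On the second track, starting no later than `b * D` forces `a < b`, and then the interval ends
  -- one short of `b * D`.
  edge-avoids-high : ∀ {a b} → a ≤ b → ¬ Meet₃ (edgeLo a b) (edgeLen a b) (vertexLo b) 0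
  edge-avoids-high a≤b (zero , p , _) =
    1+n≰n (≤-trans (≤-trans p (≤-reflexive (+-identityʳ _))) (∸-monoʳ-≤ n a≤b))
  edge-avoids-high {a} {b} a≤b (suc zero , p , q) = 1+n≰n (≤-trans (≤-reflexive (edge-end a<b)) q)
    where
    a<b : a < b
    a<b = ≰⇒> λ b≤a → 1+n≰n (≤-trans (≤-trans p (≤-reflexive (+-identityʳ _))) (*-monoˡ-≤ D b≤a))
  edge-avoids-high a≤b (suc (suc zero) , p , _) = 1+n≰n (≤-trans p (≤-reflexive (+-identityʳ _)))

  -- With length at least `n` the interval passes every vertex on the outer tracks, so only its left
  -- endpoint matters there; on the middle track both endpoints do.
  edge-meets-vertex : ∀ {a b w} → a ≤ n → w < n → w ≢ a → w ≢ b →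
    Meet₃ (edgeLo a b) (edgeLen a b) (vertexLo w) 0
  edge-meets-vertex {a} {b} {w} a≤n w<n w≢a w≢b with <-cmp w a | <-cmp w b
  ... | tri≈ _ w≡a _ | _ = contradiction w≡a w≢a
  ... | _ | tri≈ _ w≡b _ = contradiction w≡b w≢b
  ... | tri< w<a _ _ | _ = zero , ≤-trans (∸-monoʳ-< w<a a≤n) (m≤m+n _ 0) ,
    ≤-trans (m∸n≤m n w) (≤-trans (n≤edgeLen a b) (m≤n+m _ (1 + (n ∸ a))))
  ... | tri> _ _ a<w | tri> _ _ b<w = suc (suc zero) , ≤-trans b<w (m≤m+n w 0) ,
    ≤-trans (<⇒≤ w<n) (≤-trans (n≤edgeLen a b) (m≤n+m _ (1 + b)))
  ... | tri> _ _ a<w | tri< w<b _ _ = suc zero ,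
    ≤-trans (step a<w) (m≤m+n _ 0) ,
    s≤s⁻¹ (≤-trans (step w<b) (≤-reflexive (sym (edge-end (<-trans a<w w<b)))))
    where
    step : ∀ {c d} → c < d → suc (c * D) ≤ d * D
    step {c} {d} c<d = ≤-trans (+-monoˡ-≤ (c * D) 1≤D) (*-monoˡ-≤ D c<d)
      where
      1≤D : 1 ≤ D
      1≤D = ≤-trans (≤-trans (s≤s z≤n) (m≤n+m 2 T)) (m≤n+m (T + 2) n)

  -- On the first track all left endpoints lie between 1 and `n + 1`, and all lengths are at least
  -- `n`.
  edge-meets-edge : ∀ {a b a′ b′} → Meet₃ (edgeLo a b) (edgeLen a b) (edgeLo a′ b′) (edgeLen a′ b′)
  edge-meets-edge {a} {b} {a′} {b′} = zero , half a a′ b′ , half a′ a b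
    where
    half : ∀ a a′ b′ → 1 + (n ∸ a) ≤ 1 + (n ∸ a′) + edgeLen a′ b′
    half a a′ b′ = s≤s (≤-trans (m∸n≤m n a) (≤-trans (n≤edgeLen a′ b′) (m≤n+m _ (n ∸ a′))))

  edge-meets-filler : ∀ {a b q} → q < T →
    Meet₃ (edgeLo a b) (edgeLen a b) (λ _ → 1 + (n + q)) 0
  edge-meets-filler {a} {b} {q} q<T = zero ,
    ≤-trans (s≤s (≤-trans (m∸n≤m n a) (m≤m+n n q))) (m≤m+n _ 0) ,
    s≤s (≤-trans (≤-trans (+-monoʳ-≤ n (<⇒≤ q<T)) (m≤m+n (n + T) _)) (m≤n+m _ (n ∸ a)))

  -- Fillers occupy points from `n + 1` to `n + T`. Vertices lie at `n` or below on the outer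
  -- tracks, and at 0 or at `D` and beyond on the middle one.
  vertex-avoids-filler : ∀ {w q} → w < n → q < T → ¬ Meet₃ (vertexLo w) 0 (λ _ → 1 + (n + q)) 0
  vertex-avoids-filler {w} w<n q<T (zero , m) = 1+n≰n (≤-trans
    (≤-trans (s≤s (m≤m+n n _)) (≤-reflexive (sym (points-meet m)))) (m∸n≤m n w))
  vertex-avoids-filler {zero} w<n q<T (suc zero , m) with () ← points-meet m
  vertex-avoids-filler {suc w} {q} w<n q<T (suc zero , m) = 1+n≰n (begin
    suc (suc (n + q))    ≡⟨ +-suc (suc n) q ⟨
    suc n + suc q        ≤⟨ +-monoʳ-≤ (suc n) q<T ⟩
    suc n + T            ≡⟨ solve 2 (λ n T → con 1 :+ n :+ T := n :+ (T :+ con 1)) refl n T ⟩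
    n + (T + 1)          ≤⟨ +-monoʳ-≤ n (+-monoʳ-≤ T (s≤s z≤n)) ⟩
    D                    ≤⟨ m≤m+n D (w * D) ⟩
    suc w * D            ≡⟨ points-meet m ⟩
    suc (n + q)          ∎)
    where
    open ≤-Reasoning
    open +-*-Solver
  vertex-avoids-filler w<n q<T (suc (suc zero) , m) = <⇒≱ w<n
    (≤-trans (≤-trans (m≤m+n n _) (n≤1+n _)) (≤-reflexive (sym (points-meet m))))

module _ where
  open FromLayout threeTracks

  threeTracks-gadget : ∀ x → let open At x in
    Gadget graph N (complement (intersectionGraph family))
  threeTracks-gadget x = record
    { item       = itemAt
    ; index      = itemIndex
    ; item-index = itemAt-index
    ; index-item = itemIndex-at {n} {N}
    ; hub-hub    = λ a b p q a≢b → ¬meet⇒co-adj a b (kind-hub a p) (kind-hub b q) a≢b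
                     (λ (i , m) → a≢b (fillers-injective a b (points-meet m)))
    ; vtx-hub    = λ u i → ¬meet⇒co-adj (vtx u) (hub u i) refl refl (λ ())
                     (vertex-avoids-filler (toℕ<n u) (index<T (hub u i)) ∘ vertexMeet u)
    ; pair-fst   = λ u v g → ¬meet⇒co-adj (pair u v) (vtx u) (kind-good u v g) refl (λ ()) (avoids-fst u v)
    ; pair-snd   = λ u v g → ¬meet⇒co-adj (pair u v) (vtx v) (kind-good u v g) refl (λ ()) (avoids-snd u v)
    ; pair-only  = pair-only
    }
    where
    open At x
    open ThreeTracks n T hiding (D)

    index<T : ∀ a → val qᴱ (itemRegs a) < T
    index<T a = subst (_< T) (toℕ-index a) (toℕ<n (itemIndex a))

    -- Distinct items have distinct numbers, so the fillers are pairwise disjoint points and form a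
    -- clique in the complement.
    fillers-injective : ∀ a b → 1 + (n + val qᴱ (itemRegs a)) ≡ 1 + (n + val qᴱ (itemRegs b)) → a ≡ b
    fillers-injective a b eq = trans (sym (itemAt-index a)) (trans (cong itemAt (toℕ-injective
      (trans (toℕ-index a) (trans (+-cancelˡ-≡ (suc n) _ _ eq) (sym (toℕ-index b)))))) (itemAt-index b))

    vertexLo-≗ : ∀ w → loAs vertex (vtx w) ≗ vertexLo (toℕ w)
    vertexLo-≗ w zero             = refl
    vertexLo-≗ w (suc zero)       = refl
    vertexLo-≗ w (suc (suc zero)) = refl

    vertexMeet : ∀ w {lo l} → Meet₃ (loAs vertex (vtx w)) 0 lo l → Meet₃ (vertexLo (toℕ w)) 0 lo l
    vertexMeet w (i , m) = i , subst (λ c → Meet c 0 _ _) (vertexLo-≗ w i) m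

    -- The intervals of `pair u v` depend only on the unordered pair of its ends; sorting the ends
    -- evaluates the truncated subtractions of the layout.
    record Ends (u v : Fin n) : Set where
      field
        low high : Fin n
        low≤high : toℕ low ≤ toℕ high
        ends     : (low ≡ u × high ≡ v) ⊎ (low ≡ v × high ≡ u)
        lo-≗     : loAs edge (pair u v) ≗ edgeLo (toℕ low) (toℕ high)
        len-≡    : lenAs edge (pair u v) ≡ edgeLen (toℕ low) (toℕ high)

    sortedEnds : ∀ u v → Ends u v
    sortedEnds u v with ≤-total (toℕ u) (toℕ v)
    ... | inj₁ u≤v = record
      { low = u ; high = v ; low≤high = u≤v ; ends = inj₁ (refl , refl)
      ; lo-≗ = λ
        { zero             → cong (λ z → suc (n ∸ (toℕ u ∸ z))) (m≤n⇒m∸n≡0 u≤v)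
        ; (suc zero)       → cong (λ z → suc (toℕ u * D ∸ z)) (m≤n⇒m∸n≡0 uD≤vD)
        ; (suc (suc zero)) → cong suc (m+[n∸m]≡n u≤v) }
      ; len-≡ = cong (λ z → (n + T) + ((z + (toℕ v * D ∸ toℕ u * D)) ∸ D)) (m≤n⇒m∸n≡0 uD≤vD)
      }
      where uD≤vD = *-monoˡ-≤ D u≤v
    ... | inj₂ v≤u = record
      { low = v ; high = u ; low≤high = v≤u ; ends = inj₂ (refl , refl)
      ; lo-≗ = λ
        { zero             → cong (λ z → suc (n ∸ z)) (m∸[m∸n]≡n v≤u)
        ; (suc zero)       → cong suc (m∸[m∸n]≡n vD≤uD)
        ; (suc (suc zero)) → cong suc (trans (cong (toℕ u +_) (m≤n⇒m∸n≡0 v≤u)) (+-identityʳ _)) }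
      ; len-≡ = cong (λ z → (n + T) + (z ∸ D))
          (trans (cong ((toℕ u * D ∸ toℕ v * D) +_) (m≤n⇒m∸n≡0 vD≤uD)) (+-identityʳ _))
      }
      where vD≤uD = *-monoˡ-≤ D v≤u

    module _ (u v : Fin n) where
      open Ends (sortedEnds u v)

      edgeMeet : ∀ {lo lo′ l} → lo ≗ lo′ → Meet₃ (loAs edge (pair u v)) (lenAs edge (pair u v)) lo l →
        Meet₃ (edgeLo (toℕ low) (toℕ high)) (edgeLen (toℕ low) (toℕ high)) lo′ l
      edgeMeet lo≗lo′ (i , m) rewrite lo-≗ i | len-≡ | lo≗lo′ i = i , m

      edgeMeet⁻ : ∀ {lo lo′ l} → lo ≗ lo′ → 
        Meet₃ (edgeLo (toℕ low) (toℕ high)) (edgeLen (toℕ low) (toℕ high)) lo′ l →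
        Meet₃ (loAs edge (pair u v)) (lenAs edge (pair u v)) lo l
      edgeMeet⁻ {lo′ = lo′} {l} lo≗lo′ (i , m) =
        i , subst₂ (λ c d → Meet c (lenAs edge (pair u v)) d _) (sym (lo-≗ i)) (sym (lo≗lo′ i))
              (subst (λ l′ → Meet (edgeLo (toℕ low) (toℕ high) i) l′ (lo′ i) l) (sym len-≡) m)

      avoids-ends : ∀ w → w ≡ low ⊎ w ≡ high → ¬ MeetAs (pair u v) edge (vtx w) vertex
      avoids-ends w (inj₁ refl) = edge-avoids-low low≤high ∘ edgeMeet (vertexLo-≗ w)
      avoids-ends w (inj₂ refl) = edge-avoids-high low≤high ∘ edgeMeet (vertexLo-≗ w)

      avoids-fst : ¬ MeetAs (pair u v) edge (vtx u) vertex
      avoids-fst with ends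
      ... | inj₁ (eq , _) = avoids-ends u (inj₁ (sym eq))
      ... | inj₂ (_ , eq) = avoids-ends u (inj₂ (sym eq))

      avoids-snd : ¬ MeetAs (pair u v) edge (vtx v) vertex
      avoids-snd with ends
      ... | inj₁ (_ , eq) = avoids-ends v (inj₂ (sym eq))
      ... | inj₂ (eq , _) = avoids-ends v (inj₁ (sym eq))

      meets-vertex : ∀ w → w ≢ u → w ≢ v → MeetAs (pair u v) edge (vtx w) vertex
      meets-vertex w w≢u w≢v = edgeMeet⁻ (vertexLo-≗ w)
        (edge-meets-vertex (<⇒≤ (toℕ<n low)) (toℕ<n w) (proj₁ apart ∘ toℕ-injective) (proj₂ apart ∘ toℕ-injective))
        where
        apart : w ≢ low × w ≢ high
        apart with ends
        ... | inj₁ (l , h) = (λ e → w≢u (trans e l)) , (λ e → w≢v (trans e h))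
        ... | inj₂ (l , h) = (λ e → w≢v (trans e l)) , (λ e → w≢u (trans e h))

      meets-filler : ∀ b → MeetAs (pair u v) edge b filler
      meets-filler b = edgeMeet⁻ (λ _ → refl) (edge-meets-filler (index<T b))

    meets-edge : ∀ u v u′ v′ → MeetAs (pair u v) edge (pair u′ v′) edge
    meets-edge u v u′ v′ = edgeMeet⁻ u v F.lo-≗ (subst
      (Meet₃ (edgeLo (toℕ E.low) (toℕ E.high)) (edgeLen (toℕ E.low) (toℕ E.high)) (edgeLo (toℕ F.low) (toℕ F.high)))
      (sym F.len-≡) (edge-meets-edge {toℕ E.low}))
      where
      module E = Ends (sortedEnds u v)
      module F = Ends (sortedEnds u′ v′)

    pair-only : ∀ u v b → Good graph u v →
      Adj (complement (intersectionGraph family)) (itemIndex (pair u v)) (itemIndex b) →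
      b ≡ vtx u ⊎ b ≡ vtx v
    pair-only u v (vtx w) g e with w ≟ u | w ≟ v
    ... | yes refl | _        = inj₁ refl
    ... | no _     | yes refl = inj₂ refl
    ... | no w≢u   | no w≢v   = contradiction (meets-vertex u v w w≢u w≢v)
      (co-adj⇒¬meet (pair u v) (vtx w) (kind-good u v g) refl e)
    pair-only u v b@(hub _ _) g e = contradiction (meets-filler u v b)
      (co-adj⇒¬meet (pair u v) b (kind-good u v g) refl e)
    pair-only u v b@(pair u′ v′) g e with good? u′ v′
    ... | yes g′ = contradiction (meets-edge u v u′ v′)
      (co-adj⇒¬meet (pair u v) b (kind-good u v g) (kind-good u′ v′ g′) e)
    ... | no ¬g  = contradiction (meets-filler u v b)
      (co-adj⇒¬meet (pair u v) b (kind-good u v g) (kind-hub b ¬g) e)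

theorem14 : W[1]-Hard (BalancedTrackCutting 2) × W[1]-Hard (CoBalancedTrackCutting 3)
theorem14 =
  FromLayout.reduction twoTracks intersectionGraph (λ _ → refl) twoTracks-gadget ,
  FromLayout.reduction threeTracks (λ F → complement (intersectionGraph F)) (λ _ → refl) threeTracks-gadget
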